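{- Let $G$ be a $(q+1,12)$-Moore graph with $q$ an odd prime power, $q\ge 9$. Then $$q^5-2q^4-4q^2+9q-18+\frac{42}{q+2}\le \chi_\rho (G)\le q^5+q^4-2q^3-q^2+4.$$
   Context: All graphs are finite, simple and undirected; $d(u,v)$ denotes the graph distance. A packing $k$-coloring of a graph $G$ is a function $\Gamma: V(G)\to\{1,2,\dots,k\}$ such that for every $i$, any two distinct vertices of color $i$ are at distance at least $i+1$. The packing chromatic number $\chi_\rho(G)$ is the smallest integer $k$ for which $G$ has a packing $k$-coloring. A $(k,g)$-graph is a $k$-regular graph of girth $g$. For $g$ even and $k\ge 3$, a $(k,g)$-Moore graph is a $(k,g)$-graph with exactly $n_0(k,g)=\frac{2(k-1)^{g/2}-2}{k-2}$ vertices, the minimum possible. In particular a $(q+1,12)$-Moore graph has $2(q+1)(q^4+q^2+1)$ vertices; it is the point-line incidence graph of a symmetric generalized $6$-gon (generalized hexagon) of order $q$. -}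

module Defs where

open import Data.Fin using (Fin; toℕ)
open import Data.Fin.Base using (finToFun; funToFin)
open import Data.Fin.Properties using (any?; all?; finToFun-funToFin) renaming (_≟_ to _≟ᶠ_)
open import Data.List using (List; []; _∷_; length; filter; allFin)
open import Data.List.Relation.Unary.Unique.Propositional using (Unique)
open import Data.Nat
open import Data.Nat.Divisibility using (_∣_)
open import Data.Nat.DivMod using (_/_)
open import Data.Nat.Primality using (Prime)
open import Data.Nat.Properties using (allUpTo?; anyUpTo?; ≮⇒≥; <⇒≱; m<n⇒0<n∸m)
open import Data.Nat.Induction using (<-rec)
open import Data.Product using (∃; ∃₂; ∃-syntax; _×_; _,_; proj₁; proj₂)
open import Function using (id; _∘_)
open import Level using (0ℓ)
open import Relation.Binary using (Rel; Symmetric; Irreflexive)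
import Relation.Binary as Binary
open import Relation.Binary.PropositionalEquality using (_≡_; _≢_; _≗_; refl; sym; trans; subst)
open import Relation.Nullary using (¬_; Dec; yes; no; contradiction; ¬?)
open import Relation.Nullary.Decidable using (map′; _×-dec_; _→-dec_)
open import Relation.Unary using (Pred; Decidable)

IsLeast : Pred ℕ 0ℓ → Pred ℕ 0ℓ
IsLeast P m = P m × (∀ k → P k → m ≤ k)

least : ∀ {P : Pred ℕ 0ℓ} → Decidable P → ∀ n → P n → ∃ (IsLeast P)
least {P} P? = <-rec (λ n → P n → ∃ (IsLeast P)) search
  where
  search : ∀ n → (∀ {m} → m < n → P m → ∃ (IsLeast P)) → P n → ∃ (IsLeast P)
  search n rec Pn with anyUpTo? P? n
  ... | yes (m , m<n , Pm) = rec m<n Pm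
  ... | no none            = n , Pn , λ k Pk → ≮⇒≥ λ k<n → none (k , k<n , Pk)

isLeast? : ∀ {P : Pred ℕ 0ℓ} → Decidable P → Decidable (IsLeast P)
isLeast? P? m = P? m ×-dec map′
  (λ none k Pk → ≮⇒≥ λ k<m → none k<m Pk)
  (λ min {k} k<m Pk → <⇒≱ k<m (min k Pk))
  (allUpTo? (¬? ∘ P?) m)

-- Finite simple graphs, with the vertices enumerated and adjacency decidable.
record Graph : Set₁ where
  field
    order  : ℕ
    Adj    : Rel (Fin order) 0ℓ
    adj?   : Binary.Decidable Adj
    symm   : Symmetric Adj
    irrefl : Irreflexive _≡_ Adj

  Vertex : Set
  Vertex = Fin order

  degree : Vertex → ℕ
  degree v = length (filter (adj? v) (allFin order))

  IsRegular : ℕ → Set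
  IsRegular k = ∀ v → degree v ≡ k

  data Walk : Vertex → Vertex → ℕ → Set where
    []  : ∀ {u} → Walk u u 0
    _∷_ : ∀ {u v w m} → Adj u v → Walk v w m → Walk u w (suc m)

  vertices : ∀ {u v m} → Walk u v m → List Vertex
  vertices {u} []      = u ∷ []
  vertices {u} (_ ∷ p) = u ∷ vertices p

  -- A cycle of length m + 1 ≥ 3 is a path with m edges together with an edge
  -- joining its two ends.
  data Cycle : ℕ → Set where
    cycle : ∀ {u v m} → 2 ≤ m → (p : Walk u v m) → Unique (vertices p) →
            Adj v u → Cycle (suc m)

  HasGirth : ℕ → Set
  HasGirth = IsLeast Cycle

  -- HasDistance u v d says that d(u,v) = d.  It holds for no d when u and v lie
  -- in different components, that is, when d(u,v) = ∞.
  HasDistance : Vertex → Vertex → ℕ → Set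
  HasDistance u v = IsLeast (Walk u v)

  DistanceAtLeast : ℕ → Vertex → Vertex → Set
  DistanceAtLeast b u v = ∀ d → HasDistance u v d → b ≤ d

  -- The element c of Fin k stands for the colour toℕ c + 1 of {1,…,k}.
  colour : ∀ {k} → Fin k → ℕ
  colour c = suc (toℕ c)

  IsPackingColouring : ∀ {k} → (Vertex → Fin k) → Set
  IsPackingColouring Γ =
    ∀ u v → u ≢ v → Γ u ≡ Γ v → DistanceAtLeast (colour (Γ u) + 1) u v

  PackingColourable : ℕ → Set
  PackingColourable k = ∃[ Γ ] IsPackingColouring {k} Γ

  walk? : ∀ u v → Decidable (Walk u v)
  walk? u v zero    = map′ (λ { refl → [] }) (λ { [] → refl }) (u ≟ᶠ v)
  walk? u v (suc m) = map′
    (λ { (_ , a , p) → a ∷ p }) (λ { (a ∷ p) → _ , a , p })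
    (any? λ w → adj? u w ×-dec walk? w v m)

  distanceAtLeast? : ∀ b u v → Dec (DistanceAtLeast b u v)
  distanceAtLeast? b u v = map′
    (λ none d Dd → ≮⇒≥ λ d<b → none d<b Dd)
    (λ far {d} d<b Dd → <⇒≱ d<b (far d Dd))
    (allUpTo? (¬? ∘ isLeast? (walk? u v)) b)
  
  isPackingColouring? : ∀ {k} (Γ : Vertex → Fin k) → Dec (IsPackingColouring Γ)
  isPackingColouring? Γ = all? λ u → all? λ v →
    ¬? (u ≟ᶠ v) →-dec ((Γ u ≟ᶠ Γ v) →-dec distanceAtLeast? (colour (Γ u) + 1) u v)

  isPackingColouring-resp-≗ : ∀ {k} {Γ Δ : Vertex → Fin k} → Γ ≗ Δ →
    IsPackingColouring Γ → IsPackingColouring Δ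
  isPackingColouring-resp-≗ Γ≗Δ packing u v u≢v Δu≡Δv =
    subst (λ c → DistanceAtLeast (colour c + 1) u v) (Γ≗Δ u)
      (packing u v u≢v (trans (Γ≗Δ u) (trans Δu≡Δv (sym (Γ≗Δ v)))))

  packingColourable? : Decidable PackingColourable
  packingColourable? k = map′
    (λ { (i , packing) → finToFun i , packing })
    (λ { (Γ , packing) → funToFin Γ ,
           isPackingColouring-resp-≗ (sym ∘ finToFun-funToFin Γ) packing })
    (any? {n = k ^ order} λ i → isPackingColouring? (finToFun i))

  packingColourable-order : PackingColourable order
  packingColourable-order = id , λ u v u≢v u≡v → contradiction u≡v u≢v

  leastPackingColourable : ∃ (IsLeast PackingColourable)
  leastPackingColourable = least packingColourable? order packingColourable-order

  χρ : ℕ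
  χρ = proj₁ leastPackingColourable

  χρ-isLeast : IsLeast PackingColourable χρ
  χρ-isLeast = proj₂ leastPackingColourable

open Graph public using (χρ)

-- For k ≥ 3 and g ≥ 2 even both the subtractions and the divisions are exact.
n₀ : (k g : ℕ) .{{_ : NonZero (k ∸ 2)}} → ℕ
n₀ k g = (2 * (k ∸ 1) ^ (g / 2) ∸ 2) / (k ∸ 2)

record IsMooreGraph (k g : ℕ) (G : Graph) : Set where
  open Graph G
  field
    k≥3     : 3 ≤ k
    g-even  : 2 ∣ g
    regular : IsRegular k
    girth   : HasGirth g
    size    : order ≡ n₀ k g {{>-nonZero (m<n⇒0<n∸m k≥3)}}

IsPrimePower : ℕ → Set
IsPrimePower q = ∃₂ λ p e → Prime p × 1 ≤ e × q ≡ p ^ e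

IsOdd : ℕ → Set
IsOdd q = ¬ 2 ∣ q

{-# OPTIONS --safe #-}
-- A (q + 1 , 12)-Moore graph has diameter 6, because the two trees of
-- non-backtracking walks of length at most 5 hanging off an edge are disjoint
-- and already contain N + N vertices, N = 1 + q + … + q⁵; it is bipartite, with
-- sides ("points" and "lines") of size N.
--
-- Lower bound: a set with pairwise distances greater than r is bounded by
-- packing balls around vertices (r = 2, 4) or around edges (r = 1, 3, 5), and
-- by 1 for r ≥ 6.  For r = 4 the two sides are counted separately, which gains
-- the last unit over the bound obtained from all balls of radius 2.
--
-- Upper bound: colour 1 goes to the points, colours 2 and 3 go to two disjoint
-- sets of pairwise disjoint lines, and every other line gets its own colour.
-- In a maximum set of disjoint lines, the lines that meet exactly one member t
-- all pass through a single point of t, since otherwise t could be exchanged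
-- for two of them; counting intersections, q + 1 times q + 2 times the size of
-- the set is at least twice the number of lines available.
module Submission where

open import Defs

module PackingBounds where
  open import Data.Bool using (Bool; true; false; not; _∧_; _∨_; if_then_else_; T)
  open import Data.Bool.Properties using (not-involutive; not-¬; T?)
  open import Data.Empty using (⊥; ⊥-elim)
  open import Data.Fin using (Fin; zero; suc; toℕ)
  open import Data.Fin.Properties using (suc-injective; 0≢1+n; toℕ-injective) renaming (_≟_ to _≟ᶠ_)
  open import Data.List using (List; []; _∷_; length; filter; tabulate; allFin; lookup)
  open import Data.List.Membership.DecPropositional using (_∈?_)
  open import Data.List.Membership.Propositional using (_∈_)
  open import Data.List.Membership.Propositional.Properties using (∈-filter⁺; ∈-allFin)
  open import Data.List.Relation.Unary.All as All using ([]; _∷_)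
  open import Data.List.Relation.Unary.All.Properties using (¬Any⇒All¬)
  open import Data.List.Relation.Unary.AllPairs using ([]; _∷_)
  open import Data.List.Relation.Unary.Any using (here; there; index)
  open import Data.List.Relation.Unary.Any.Properties using (lookup-index)
  open import Data.List.Relation.Unary.Unique.Propositional using (Unique)
  open import Data.Nat
  open import Data.Nat.DivMod using (m*n/n≡m)
  open import Data.Nat.Properties hiding (suc-injective; 0≢1+n)
  open import Data.Nat.Tactic.RingSolver using (solve-∀)
  open import Data.Product using (∃; ∃₂; Σ; _×_; _,_; proj₁; proj₂)
  open import Data.Sum as Sum using (_⊎_; inj₁; inj₂)
  open import Function using (id; _∘_; case_of_)
  open import Level using (0ℓ)
  open import Relation.Binary.PropositionalEquality
  open import Relation.Nullary using (¬_; Dec; yes; no; does; contradiction)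
  open import Relation.Nullary.Decidable using (dec-true; dec-false; decidable-stable)
  open import Relation.Unary using (Pred; Decidable)
  open import Algebra.Properties.Semiring.Sum +-*-semiring
    using (sum; sum-cong-≗; ∑-distrib-+; ∑-comm; *-distribˡ-sum; *-distribʳ-sum)

  -- Sums and the adjacency operator

  ⟦_⟧ : Bool → ℕ
  ⟦ b ⟧ = if b then 1 else 0

  ⟦⟧≤1 : ∀ b → ⟦ b ⟧ ≤ 1
  ⟦⟧≤1 true  = ≤-refl
  ⟦⟧≤1 false = z≤n

  ⟦⟧-pos : ∀ {b} → 0 < ⟦ b ⟧ → b ≡ true
  ⟦⟧-pos {true} _ = refl

  does-true : ∀ {A : Set} (d : Dec A) → does d ≡ true → A
  does-true (yes x) _ = x

  does-pos : ∀ {A : Set} (d : Dec A) → 0 < ⟦ does d ⟧ → A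
  does-pos d pos = does-true d (⟦⟧-pos pos)

  ⟦⟧-yes : ∀ {A : Set} (d : Dec A) → A → ⟦ does d ⟧ ≡ 1
  ⟦⟧-yes d x = cong ⟦_⟧ (dec-true d x)

  ⟦⟧-no : ∀ {A : Set} (d : Dec A) → ¬ A → ⟦ does d ⟧ ≡ 0
  ⟦⟧-no d ¬x = cong ⟦_⟧ (dec-false d ¬x)

  *-pos : ∀ {m n} → 0 < m * n → 0 < m × 0 < n
  *-pos {suc m} {suc n} _ = z<s , z<s
  *-pos {suc m} {zero}  p rewrite *-zeroʳ m = contradiction p λ ()

  +-pos : ∀ {m n} → 0 < m + n → 0 < m ⊎ 0 < n
  +-pos {zero}  p = inj₂ p
  +-pos {suc m} p = inj₁ z<s

  pos-or-zero : ∀ m → 0 < m ⊎ m ≡ 0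
  pos-or-zero zero    = inj₂ refl
  pos-or-zero (suc m) = inj₁ z<s

  -- Disjointness of balls and trees enters in this form: of two counts that cannot both be positive
  -- one vanishes, so a common bound holds for the sum.
  exclusive-sum≤ : ∀ {m n B} → m ≤ B → n ≤ B → (0 < m → 0 < n → ⊥) → m + n ≤ B
  exclusive-sum≤ {zero}          _   n≤B _    = n≤B
  exclusive-sum≤ {suc m} {zero}  m≤B _   _    = ≤-trans (≤-reflexive (+-identityʳ _)) m≤B
  exclusive-sum≤ {suc m} {suc n} _   _   excl = ⊥-elim (excl z<s z<s)

  sum-mono : ∀ {n} {f g : Fin n → ℕ} → (∀ i → f i ≤ g i) → sum f ≤ sum g
  sum-mono {zero}  f≤g = z≤n
  sum-mono {suc n} f≤g = +-mono-≤ (f≤g zero) (sum-mono (f≤g ∘ suc))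

  sum-const : ∀ n c → sum {n} (λ _ → c) ≡ n * c
  sum-const zero    c = refl
  sum-const (suc n) c = cong (c +_) (sum-const n c)

  sum-pos : ∀ {n} (f : Fin n → ℕ) → 0 < sum f → ∃ λ i → 0 < f i
  sum-pos {suc n} f p with +-pos {f zero} p
  ... | inj₁ q = zero , q
  ... | inj₂ q = let i , r = sum-pos (f ∘ suc) q in suc i , r

  sum-unique : ∀ {n B} (f : Fin n → ℕ) → (∀ i → f i ≤ B) →
    (∀ i j → 0 < f i → 0 < f j → i ≡ j) → sum f ≤ B
  sum-unique {zero}  f f≤B uniq = z≤n
  sum-unique {suc n} f f≤B uniq = exclusive-sum≤ (f≤B zero)
    (sum-unique (f ∘ suc) (f≤B ∘ suc) λ i j p q → suc-injective (uniq (suc i) (suc j) p q))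
    λ p q → let j , r = sum-pos (f ∘ suc) q in 0≢1+n (uniq zero (suc j) p r)

  sum-δ : ∀ {n} (a : Fin n) (f : Fin n → ℕ) → sum (λ i → ⟦ does (i ≟ᶠ a) ⟧ * f i) ≡ f a
  sum-δ {suc n} zero    f = begin
    f zero + 0 + sum {n} (λ _ → 0)  ≡⟨ cong₂ _+_ (+-identityʳ _) (sum-const n 0) ⟩
    f zero + n * 0                  ≡⟨ cong (f zero +_) (*-zeroʳ n) ⟩
    f zero + 0                      ≡⟨ +-identityʳ _ ⟩
    f zero                          ∎
    where open ≡-Reasoning
  sum-δ {suc n} (suc a) f = sum-δ a (f ∘ suc)

  sum-δ-1 : ∀ {n} (a : Fin n) → sum (λ i → ⟦ does (i ≟ᶠ a) ⟧) ≡ 1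
  sum-δ-1 {n} a = trans (sum-cong-≗ {n} λ i → sym (*-identityʳ _)) (sum-δ a λ _ → 1)

  -- Pigeonhole: a zero term would leave at most `n - 1` for all the others.
  full-sum-pos : ∀ {n} (f : Fin n → ℕ) → (∀ i → f i ≤ 1) → n ≤ sum f → ∀ i → 0 < f i
  full-sum-pos {suc n} f f≤1 n≤∑ i with f zero in eq | f≤1 zero
  ... | zero  | _       = contradiction n≤∑ (<⇒≱ (s≤s ∑≤n))
    where
    ∑≤n : sum (f ∘ suc) ≤ n
    ∑≤n = ≤-trans (sum-mono (f≤1 ∘ suc)) (≤-reflexive (trans (sum-const n 1) (*-identityʳ n)))
  full-sum-pos f f≤1 n≤∑ zero    | suc zero | _ = ≤-reflexive (sym eq)
  full-sum-pos f f≤1 n≤∑ (suc i) | suc zero | _ = full-sum-pos (f ∘ suc) (f≤1 ∘ suc) (s≤s⁻¹ n≤∑) i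
  full-sum-pos f f≤1 n≤∑ i       | suc (suc _) | s≤s ()

  term≤sum : ∀ {n} (f : Fin n → ℕ) i → f i ≤ sum f
  term≤sum f zero    = m≤m+n _ _
  term≤sum f (suc i) = ≤-trans (term≤sum (f ∘ suc) i) (m≤n+m _ _)

  two-terms≤sum : ∀ {n} (f : Fin n → ℕ) {i j} → i ≢ j → f i + f j ≤ sum f
  two-terms≤sum f {zero}  {zero}  i≢j = contradiction refl i≢j
  two-terms≤sum f {zero}  {suc j} _   = +-monoʳ-≤ (f zero) (term≤sum (f ∘ suc) j)
  two-terms≤sum f {suc i} {zero}  _   =
    ≤-trans (≤-reflexive (+-comm _ (f zero))) (+-monoʳ-≤ (f zero) (term≤sum (f ∘ suc) i))
  two-terms≤sum f {suc i} {suc j} i≢j = ≤-trans (two-terms≤sum (f ∘ suc) (i≢j ∘ cong suc)) (m≤n+m _ _)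

  length-filter : ∀ {A : Set} {n} {P : Pred A 0ℓ} (P? : Decidable P) (f : Fin n → A) →
    length (filter P? (tabulate f)) ≡ sum (λ i → ⟦ does (P? (f i)) ⟧)
  length-filter {n = zero}  P? f = refl
  length-filter {n = suc n} P? f with does (P? (f zero))
  ... | true  = cong suc (length-filter P? (f ∘ suc))
  ... | false = length-filter P? (f ∘ suc)

  module Adjacency (G : Graph) where
    open Graph G

    ∑ : (Vertex → ℕ) → ℕ
    ∑ = sum {order}

    ∑-cong : ∀ {f g} → f ≗ g → ∑ f ≡ ∑ g
    ∑-cong = sum-cong-≗ {order}

    ∑-mono : ∀ {f g} → (∀ u → f u ≤ g u) → ∑ f ≤ ∑ g
    ∑-mono = sum-mono {order}

    ∑-+ : ∀ f g → ∑ (λ u → f u + g u) ≡ ∑ f + ∑ g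
    ∑-+ = ∑-distrib-+ {order}

    ∑-*ˡ : ∀ c f → ∑ (λ u → c * f u) ≡ c * ∑ f
    ∑-*ˡ c f = sym (*-distribˡ-sum c f)

    ∑-*ʳ : ∀ c f → ∑ (λ u → f u * c) ≡ ∑ f * c
    ∑-*ʳ c f = sym (*-distribʳ-sum c f)

    ∑-swap : ∀ f → ∑ (λ u → ∑ (f u)) ≡ ∑ (λ w → ∑ λ u → f u w)
    ∑-swap = ∑-comm {order} {order}

    ∑-1 : ∑ (λ _ → 1) ≡ order
    ∑-1 = trans (sum-const order 1) (*-identityʳ order)

    Subset : Set
    Subset = Vertex → Bool

    ∣_∣ : Subset → ℕ
    ∣ σ ∣ = ∑ λ x → ⟦ σ x ⟧

    a : Vertex → Vertex → ℕ
    a u w = ⟦ does (adj? u w) ⟧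

    -- The adjacency matrix acting on weights. Iterated on the indicator of a set, it counts walks
    -- into the set, turning back allowed.
    M : (Vertex → ℕ) → Vertex → ℕ
    M f u = ∑ λ w → a u w * f w

    a-pos : ∀ {u w} → 0 < a u w → Adj u w
    a-pos {u} {w} = does-pos (adj? u w)

    a-adj : ∀ {u w} → Adj u w → a u w ≡ 1
    a-adj {u} {w} = ⟦⟧-yes (adj? u w)

    a-sym : ∀ u w → a u w ≡ a w u
    a-sym u w with adj? u w
    ... | yes e = sym (a-adj (symm e))
    ... | no ¬e = sym (⟦⟧-no (adj? w u) (¬e ∘ symm))

    adj-≢ : ∀ {u w} → Adj u w → u ≢ w
    adj-≢ e u≡w = irrefl u≡w e

    degree-M : ∀ u → M (λ _ → 1) u ≡ degree u
    degree-M u = trans (∑-cong λ w → *-identityʳ (a u w)) (sym (length-filter (adj? u) id))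

    M-term-mono : ∀ {u w m n} → (Adj u w → m ≤ n) → a u w * m ≤ a u w * n
    M-term-mono {u} {w} m≤n with adj? u w
    ... | yes e = +-monoˡ-≤ 0 (m≤n e)
    ... | no _  = z≤n

    M-mono : ∀ {f g u} → (∀ w → Adj u w → f w ≤ g w) → M f u ≤ M g u
    M-mono f≤g = ∑-mono λ w → M-term-mono (f≤g w)

    M-cong : ∀ {f g u} → (∀ w → Adj u w → f w ≡ g w) → M f u ≡ M g u
    M-cong f≡g = ≤-antisym (M-mono λ w e → ≤-reflexive (f≡g w e))
                           (M-mono λ w e → ≤-reflexive (sym (f≡g w e)))

    M-pos : ∀ {f u} → 0 < M f u → ∃ λ w → Adj u w × 0 < f w
    M-pos {f} {u} p = let w , q = sum-pos _ p ; r , s = *-pos {a u w} q in w , a-pos r , s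

    M-unique : ∀ {f u B} → (∀ w → Adj u w → f w ≤ B) →
      (∀ w w′ → Adj u w → Adj u w′ → 0 < f w → 0 < f w′ → w ≡ w′) → M f u ≤ B
    M-unique {f} {u} {B} f≤B uniq = sum-unique _
      (λ w → ≤-trans (M-term-mono (f≤B w))
        (≤-trans (*-monoˡ-≤ B (⟦⟧≤1 (does (adj? u w)))) (≤-reflexive (+-identityʳ B))))
      λ w w′ p p′ → let r , s = *-pos {a u w} p ; r′ , s′ = *-pos {a u w′} p′
                    in uniq w w′ (a-pos r) (a-pos r′) s s′

    -- Symmetry of the adjacency matrix, in the form used for double counting: a sum over edges may
    -- be read from either end.
    M-adjoint : ∀ f g → ∑ (λ u → g u * M f u) ≡ ∑ (λ u → M g u * f u)
    M-adjoint f g = begin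
      ∑ (λ u → g u * M f u)                      ≡⟨ ∑-cong (λ u → sym (∑-*ˡ (g u) _)) ⟩
      ∑ (λ u → ∑ λ w → g u * (a u w * f w))    ≡⟨ ∑-swap _ ⟩
      ∑ (λ w → ∑ λ u → g u * (a u w * f w))    ≡⟨ ∑-cong (λ w → ∑-cong λ u → swap (g u) (a-sym u w)) ⟩
      ∑ (λ w → ∑ λ u → (a w u * g u) * f w)    ≡⟨ ∑-cong (λ w → ∑-*ʳ (f w) _) ⟩
      ∑ (λ w → M g w * f w)                      ∎
      where
      open ≡-Reasoning
      swap : ∀ x {y y′ z} → y ≡ y′ → x * (y * z) ≡ y′ * x * z
      swap x {y} {z = z} refl = trans (sym (*-assoc x y z)) (cong (_* z) (*-comm x y))

    M-const : ∀ {k} → IsRegular k → ∀ c u → M (λ _ → c) u ≡ k * c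
    M-const {k} reg c u = begin
      ∑ (λ w → a u w * c)  ≡⟨ ∑-*ʳ c _ ⟩
      ∑ (a u) * c          ≡⟨ cong (_* c) (∑-cong λ w → sym (*-identityʳ (a u w))) ⟩
      M (λ _ → 1) u * c      ≡⟨ cong (_* c) (trans (degree-M u) (reg u)) ⟩
      k * c                  ∎
      where open ≡-Reasoning

    module Regular {k} (reg : IsRegular k) where

      sum-M : ∀ f → ∑ (M f) ≡ k * ∑ f
      sum-M f = begin
        ∑ (M f)                        ≡⟨ ∑-cong (λ u → sym (*-identityˡ (M f u))) ⟩
        ∑ (λ u → 1 * M f u)            ≡⟨ M-adjoint f (λ _ → 1) ⟩
        ∑ (λ u → M (λ _ → 1) u * f u)
          ≡⟨ ∑-cong (λ u → cong (_* f u) (trans (M-const reg 1 u) (*-identityʳ k))) ⟩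
        ∑ (λ u → k * f u)              ≡⟨ ∑-*ˡ k f ⟩
        k * ∑ f                        ∎
        where open ≡-Reasoning

      -- Sum the hypothesis over all pairs (u , v) with u adjacent to v.
      edge-bound : ∀ B C → (∀ {u v} → Adj u v → B u + B v ≤ 1 + (C u + C v)) →
        k * (2 * ∑ B) ≤ k * (order + 2 * ∑ C)
      edge-bound B C h = begin
        k * (2 * ∑ B)                                          ≡⟨ both-ends B ⟨
        ∑ (λ u → M (λ v → B u + B v) u)                        ≤⟨ ∑-mono (λ u → M-mono λ v e → h e) ⟩
        ∑ (λ u → M (λ v → 1 + (C u + C v)) u)
          ≡⟨ ∑-cong (λ u → M-+ (λ _ → 1) (λ v → C u + C v) u) ⟩
        ∑ (λ u → M (λ _ → 1) u + M (λ v → C u + C v) u)        ≡⟨ ∑-+ (M λ _ → 1) _ ⟩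
        ∑ (M λ _ → 1) + ∑ (λ u → M (λ v → C u + C v) u)      ≡⟨ cong₂ _+_ (sum-M λ _ → 1) (both-ends C) ⟩
        k * ∑ (λ _ → 1) + k * (2 * ∑ C)              ≡⟨ cong (λ s → k * s + k * (2 * ∑ C)) ∑-1 ⟩
        k * order + k * (2 * ∑ C)                              ≡⟨ *-distribˡ-+ k order _ ⟨
        k * (order + 2 * ∑ C)                                  ∎
        where
        open ≤-Reasoning
        M-+ : ∀ f g u → M (λ v → f v + g v) u ≡ M f u + M g u
        M-+ f g u = trans (∑-cong λ v → *-distribˡ-+ (a u v) _ _) (∑-+ (λ v → a u v * f v) _)
        both-ends : ∀ D → ∑ (λ u → M (λ v → D u + D v) u) ≡ k * (2 * ∑ D)
        both-ends D = begin-equality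
          ∑ (λ u → M (λ v → D u + D v) u)              ≡⟨ ∑-cong (λ u → M-+ (λ _ → D u) D u) ⟩
          ∑ (λ u → M (λ _ → D u) u + M D u)            ≡⟨ ∑-+ (λ u → M (λ _ → D u) u) (M D) ⟩
          ∑ (λ u → M (λ _ → D u) u) + ∑ (M D)        ≡⟨ cong₂ _+_ (∑-cong λ u → M-const reg (D u) u) (sum-M D) ⟩
          ∑ (λ u → k * D u) + k * ∑ D                ≡⟨ cong (_+ k * ∑ D) (∑-*ˡ k D) ⟩
          k * ∑ D + k * ∑ D                          ≡⟨ *-distribˡ-+ k _ _ ⟨
          k * (∑ D + ∑ D)                            ≡⟨ cong (λ s → k * (∑ D + s)) (+-identityʳ (∑ D)) ⟨
          k * (2 * ∑ D)                                ∎

  -- Moore graphs of girth 12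

  -- 1 + q + ... + q^K in Horner form, the order of a tree of depth `K` whose inner vertices have
  -- `q` children; the recursion is that of `trails`.
  geometric : ℕ → ℕ → ℕ
  geometric q zero    = 1
  geometric q (suc K) = 1 + q * geometric q K

  isEven : ℕ → Bool
  isEven zero    = true
  isEven (suc n) = not (isEven n)

  isEven-step : ∀ {m n} → n ≡ suc m ⊎ m ≡ suc n → isEven n ≡ not (isEven m)
  isEven-step (inj₁ refl) = refl
  isEven-step (inj₂ refl) = sym (not-involutive _)

  -- In terms of points and lines: by `NoSquare` two points lie on at most one line, and `NoHexagon`
  -- forbids triangles, that is, meeting lines through different points of `t`.
  NoSquare NoHexagon DiameterAtMost6 : Graph → Set
  NoSquare G = ∀ {u x w w′} → u ≢ x → Adj u w → Adj w x → Adj u w′ → Adj w′ x → w ≡ w′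
    where open Graph G
  NoHexagon G = ∀ {t p₁ p₂ ℓ₁ ℓ₂ p} → p₁ ≢ p₂ → ℓ₁ ≢ t → ℓ₂ ≢ t → ℓ₁ ≢ ℓ₂ →
    Adj t p₁ → Adj t p₂ → Adj p₁ ℓ₁ → Adj p₂ ℓ₂ → Adj ℓ₁ p → ¬ Adj ℓ₂ p
    where open Graph G
  DiameterAtMost6 G = ∀ x y → ∃ λ m → m ≤ 6 × Walk x y m
    where open Graph G

  Alternates : (G : Graph) → (Graph.Vertex G → Bool) → Set
  Alternates G σ = ∀ {x y} → Graph.Adj G x y → σ y ≡ not (σ x)

  -- Non-backtracking walks, cycles and trees

  module NonBacktracking (G : Graph) where
    open Graph G
    open Adjacency G

    -- NB p u x k: walks of length k from u to x that never turn back and whose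
    -- first step does not lead to p.
    data NB : Vertex → Vertex → Vertex → ℕ → Set where
      stop : ∀ {p u} → NB p u u 0
      step : ∀ {p u w x k} → Adj u w → w ≢ p → NB u w x k → NB p u x (suc k)

    NB⇒Walk : ∀ {p u x k} → NB p u x k → Walk u x k
    NB⇒Walk stop         = []
    NB⇒Walk (step e _ r) = e ∷ NB⇒Walk r

    end∈vertices : ∀ {u v m} (P : Walk u v m) → v ∈ vertices P
    end∈vertices []      = here refl
    end∈vertices (_ ∷ P) = there (end∈vertices P)

    -- A cycle closes on the part of a path up to the point of return. The inclusion of vertices
    -- carries over that a further vertex avoids the path.
    cut : ∀ {u v w m} (P : Walk u v m) → Unique (vertices P) → w ∈ vertices P →
      ∃ λ j → j ≤ m × Σ (Walk u w j) λ P′ →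
        Unique (vertices P′) × (∀ {y} → y ∈ vertices P′ → y ∈ vertices P)
    cut []      uniq       (here refl) = 0 , z≤n , [] , uniq , id
    cut (e ∷ P) _          (here refl) = 0 , z≤n , [] , [] ∷ [] , λ { (here y≡u) → here y≡u }
    cut (e ∷ P) (≢u ∷ uniq) (there i)  =
      let j , j≤m , P′ , uniq′ , P′⊆P = cut P uniq i in
      suc j , s≤s j≤m , e ∷ P′ ,
      All.tabulate (All.lookup ≢u ∘ P′⊆P) ∷ uniq′ ,
      λ { (here y≡u) → here y≡u ; (there y∈) → there (P′⊆P y∈) }

    -- P is the part of the closed walk already traversed, read backwards; as soon
    -- as the walk returns to it, a cycle closes up.
    first-return : ∀ {c d s j k} → Adj c d → (P : Walk d s j) → Unique (c ∷ vertices P) →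
      NB d c s k → ∃ λ m → m ≤ suc (j + k) × Cycle m
    first-return e P (c∉P ∷ _) stop = contradiction refl (All.lookup c∉P (end∈vertices P))
    first-return {c} {d} {s} {j} {suc k} e P (c∉P ∷ uniq) (step {w = w} f w≢d r) with _∈?_ _≟ᶠ_ w (vertices P)
    ... | no w∉P =
      let m , m≤ , C = first-return (symm f) (e ∷ P)
            (((λ w≡c → irrefl (sym w≡c) f) ∷ ¬Any⇒All¬ _ w∉P) ∷ c∉P ∷ uniq) r
      in m , ≤-trans m≤ (≤-reflexive (cong suc (sym (+-suc j k)))) , C
    ... | yes w∈P with cut P uniq w∈P
    -- Length 0 means a return to `d`, the vertex that the walk has just left.
    ...   | zero   , _   , [] , _ , _ = contradiction refl w≢d
    ...   | suc i , i≤j , P′ , uniq′ , P′⊆P =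
      suc (suc (suc i)) ,
      s≤s (≤-trans (s≤s i≤j) (≤-trans (≤-reflexive (+-comm 1 j)) (+-monoʳ-≤ j (s≤s z≤n)))) ,
      cycle (s≤s (s≤s z≤n)) (e ∷ P′) (All.tabulate (All.lookup c∉P ∘ P′⊆P) ∷ uniq′) (symm f)

    -- Turning back is possible only at `x`, where the walk ends; the search for the first return
    -- starts with the edge from `x` to `u` already traversed.
    closed⇒cycle : ∀ {x u k} → Adj x u → NB x u x k → ∃ λ m → m ≤ suc k × Cycle m
    closed⇒cycle e = first-return (symm e) [] (((λ u≡x → irrefl (sym u≡x) e) ∷ []) ∷ [] ∷ [])

    -- The steps of the walk from `w` are moved, reversed, in front of the walk from `u` until one
    -- closed walk is left. The conditions at the ends of the edge keep it from turning back.
    diverging⇒cycle : ∀ {u w x j k} → Adj u w → NB w u x j → NB u w x k → ∃ λ m → m ≤ suc (k + j) × Cycle m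
    diverging⇒cycle         e r stop          = closed⇒cycle (symm e) r
    diverging⇒cycle {j = j} e r (step {k = k} f v≢u s) =
      let m , m≤ , C = diverging⇒cycle f (step (symm e) (v≢u ∘ sym) r) s
      in m , ≤-trans m≤ (≤-reflexive (cong suc (+-suc k j))) , C

    -- trails K p u x counts the walks NB p u x k with k ≤ K.
    trails : ℕ → Vertex → Vertex → Vertex → ℕ
    trails zero    p u x = ⟦ does (x ≟ᶠ u) ⟧
    trails (suc K) p u x = ⟦ does (x ≟ᶠ u) ⟧ + M (λ w → ⟦ not (does (w ≟ᶠ p)) ⟧ * trails K u w x) u

    not-does-pos : ∀ {A : Set} (d : Dec A) → 0 < ⟦ not (does d) ⟧ → ¬ A
    not-does-pos (no ¬x) _ = ¬x

    trails-NB : ∀ K {p u x} → 0 < trails K p u x → ∃ λ k → k ≤ K × NB p u x k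
    trails-NB zero    {p} {u} {x} pos with does-pos (x ≟ᶠ u) pos
    ... | refl = 0 , z≤n , stop
    trails-NB (suc K) {p} {u} {x} pos with +-pos {⟦ does (x ≟ᶠ u) ⟧} pos
    ... | inj₁ x≡u with does-pos (x ≟ᶠ u) x≡u
    ...   | refl = 0 , z≤n , stop
    trails-NB (suc K) {p} {u} {x} pos | inj₂ rest =
      let w , e , pos′ = M-pos rest
          w≢p , pos″ = *-pos {⟦ not (does (w ≟ᶠ p)) ⟧} pos′
          k , k≤K , r = trails-NB K pos″
      in suc k , s≤s k≤K , step e (not-does-pos (w ≟ᶠ p) w≢p) r

    module Trees {q} (reg : IsRegular (suc q)) where

      M-∑ : ∀ (F : Vertex → Vertex → ℕ) u → ∑ (λ x → M (λ w → F w x) u) ≡ M (λ w → ∑ (F w)) u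
      M-∑ F u = trans (∑-swap λ x w → a u w * F w x) (∑-cong λ w → ∑-*ˡ (a u w) (F w))

      other-neighbours : ∀ {u p} → Adj u p → ∑ (λ w → a u w * ⟦ not (does (w ≟ᶠ p)) ⟧) ≡ q
      other-neighbours {u} {p} e = +-cancelˡ-≡ 1 _ _ (begin
        1 + ∑ (λ w → a u w * ⟦ not (does (w ≟ᶠ p)) ⟧)
          ≡⟨ cong (_+ ∑ (λ w → a u w * ⟦ not (does (w ≟ᶠ p)) ⟧)) (trans (sum-δ p (a u)) (a-adj e)) ⟨
        ∑ (λ w → ⟦ does (w ≟ᶠ p) ⟧ * a u w) + ∑ (λ w → a u w * ⟦ not (does (w ≟ᶠ p)) ⟧)
          ≡⟨ ∑-+ (λ w → ⟦ does (w ≟ᶠ p) ⟧ * a u w) _ ⟨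
        ∑ (λ w → ⟦ does (w ≟ᶠ p) ⟧ * a u w + a u w * ⟦ not (does (w ≟ᶠ p)) ⟧)
          ≡⟨ ∑-cong (λ w → split (does (w ≟ᶠ p)) (a u w)) ⟩
        M (λ _ → 1) u
          ≡⟨ trans (M-const reg 1 u) (*-identityʳ (suc q)) ⟩
        1 + q ∎)
        where
        open ≡-Reasoning
        split : ∀ b n → ⟦ b ⟧ * n + n * ⟦ not b ⟧ ≡ n * 1
        split true  n = trans (cong₂ _+_ (+-identityʳ n) (*-zeroʳ n)) (trans (+-identityʳ n) (sym (*-identityʳ n)))
        split false n = refl

      -- Walks are counted with multiplicity, so this follows from regularity: apart from its parent
      -- every vertex has `q` neighbours. The girth enters in `trails≤1`, which turns the count into
      -- a number of vertices.
      trails-sum : ∀ K {p u} → Adj u p → ∑ (trails K p u) ≡ geometric q K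
      trails-sum zero    {u = u} e = sum-δ-1 u
      trails-sum (suc K) {p} {u} e = begin
        ∑ (λ x → ⟦ does (x ≟ᶠ u) ⟧ + M (λ w → nb w * trails K u w x) u)
          ≡⟨ ∑-+ (λ x → ⟦ does (x ≟ᶠ u) ⟧) _ ⟩
        ∑ (λ x → ⟦ does (x ≟ᶠ u) ⟧) + ∑ (λ x → M (λ w → nb w * trails K u w x) u)
          ≡⟨ cong₂ _+_ (sum-δ-1 u) (M-∑ (λ w x → nb w * trails K u w x) u) ⟩
        1 + M (λ w → ∑ (λ x → nb w * trails K u w x)) u
          ≡⟨ cong suc (M-cong λ w f → trans (∑-*ˡ (nb w) (trails K u w)) (cong (nb w *_) (trails-sum K (symm f)))) ⟩
        1 + M (λ w → nb w * geometric q K) u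
          ≡⟨ cong suc (∑-cong λ w → sym (*-assoc (a u w) (nb w) _)) ⟩
        1 + ∑ (λ w → a u w * nb w * geometric q K)
          ≡⟨ cong suc (trans (∑-*ʳ _ (λ w → a u w * nb w)) (cong (_* geometric q K) (other-neighbours e))) ⟩
        1 + q * geometric q K ∎
        where
        open ≡-Reasoning
        nb : Vertex → ℕ
        nb w = ⟦ not (does (w ≟ᶠ p)) ⟧

  -- Consequences of girth 12 and the Moore size

  module Moore {q : ℕ} (G : Graph) (reg : Graph.IsRegular G (suc q))
    (girth≥12 : ∀ m → Graph.Cycle G m → 12 ≤ m)
    (size : Graph.order G ≡ 2 * geometric q 5) where
    open Graph G
    open Adjacency G
    open NonBacktracking G
    open Trees reg

    no-cycle : ∀ {n} → n ≤ 11 → ¬ ∃ λ m → m ≤ n × Cycle m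
    no-cycle n≤11 (m , m≤n , C) = <⇒≱ (girth≥12 m C) (≤-trans m≤n n≤11)

    -- Two walks to the same vertex that part at `u` close a cycle of length at most 10, and a walk
    -- back to its root closes one of length at most 5.
    trails≤1 : ∀ K p u x → K ≤ 5 → trails K p u x ≤ 1
    trails≤1 zero    p u x _   = ⟦⟧≤1 (does (x ≟ᶠ u))
    trails≤1 (suc K) p u x K<5 = exclusive-sum≤ (⟦⟧≤1 (does (x ≟ᶠ u)))
      (M-unique
        (λ w _ → *-mono-≤ (⟦⟧≤1 (not (does (w ≟ᶠ p)))) (trails≤1 K u w x (<⇒≤ K<5)))
        λ w w′ e e′ pos pos′ → decidable-stable (w ≟ᶠ w′) λ w≢w′ →
          let k , k≤K , r = branch w pos
              l , l≤K , s = branch w′ pos′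
          in no-cycle (s≤s (≤-trans (+-mono-≤ (≤-trans k≤K (s≤s⁻¹ K<5)) (s≤s (≤-trans l≤K (s≤s⁻¹ K<5)))) (m≤m+n 9 1)))
               (diverging⇒cycle e (step e′ (w≢w′ ∘ sym) s) r))
      λ x≡u pos → root≢ (does-pos (x ≟ᶠ u) x≡u) (M-pos pos)
      where
      branch : ∀ w → 0 < ⟦ not (does (w ≟ᶠ p)) ⟧ * trails K u w x → ∃ λ k → k ≤ K × NB u w x k
      branch w pos = trails-NB K (proj₂ (*-pos {⟦ not (does (w ≟ᶠ p)) ⟧} pos))
      root≢ : x ≡ u → ¬ ∃ λ w → Adj u w × 0 < ⟦ not (does (w ≟ᶠ p)) ⟧ * trails K u w x
      root≢ refl (w , e , pos) =
        let k , k≤K , r = branch w pos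
        in no-cycle (s≤s (≤-trans k≤K (≤-trans (s≤s⁻¹ K<5) (m≤m+n 4 6)))) (closed⇒cycle e r)

    -- The two trees hanging off an edge are disjoint, and together they have as
    -- many vertices as the graph.
    trees-cover : ∀ K → K ≤ 5 → order ≡ 2 * geometric q K → ∀ {u v} → Adj u v → ∀ x →
      (∃ λ k → k ≤ K × NB v u x k) ⊎ (∃ λ k → k ≤ K × NB u v x k)
    trees-cover K K≤5 order≡ {u} {v} e x
      with +-pos {trails K v u x} (full-sum-pos both both≤1 (≤-reflexive (sym both-sum)) x)
      where
      both : Vertex → ℕ
      both x = trails K v u x + trails K u v x
      both≤1 : ∀ x → both x ≤ 1
      both≤1 x = exclusive-sum≤ (trails≤1 K v u x K≤5) (trails≤1 K u v x K≤5) λ pos pos′ →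
        let k , k≤K , r = trails-NB K pos
            l , l≤K , s = trails-NB K pos′
        -- Two walks of length at most 5 and the edge give at most 11, just below the girth.
        in no-cycle (s≤s (+-mono-≤ (≤-trans l≤K K≤5) (≤-trans k≤K K≤5))) (diverging⇒cycle e r s)
      both-sum : ∑ both ≡ order
      both-sum = begin
        ∑ both                               ≡⟨ ∑-+ (trails K v u) _ ⟩
        ∑ (trails K v u) + ∑ (trails K u v)  ≡⟨ cong₂ _+_ (trails-sum K e) (trails-sum K (symm e)) ⟩
        geometric q K + geometric q K        ≡⟨ cong (geometric q K +_) (+-identityʳ _) ⟨
        2 * geometric q K                    ≡⟨ order≡ ⟨
        order                                ∎
        where open ≡-Reasoning
    ... | inj₁ pos = inj₁ (trails-NB K pos)
    ... | inj₂ pos = inj₂ (trails-NB K pos)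

    edge-covers : ∀ {u v} → Adj u v → ∀ x →
      (∃ λ k → k ≤ 5 × NB v u x k) ⊎ (∃ λ k → k ≤ 5 × NB u v x k)
    edge-covers = trees-cover 5 ≤-refl size

    -- Common first steps are stripped; where the walks part, or only one of them ends, a closed
    -- walk of length at most `m + n` remains, too short for the girth.
    NB-length-unique : ∀ {p p′ x z m n} → NB p x z m → NB p′ x z n → m + n < 12 → m ≡ n
    NB-length-unique stop stop _ = refl
    NB-length-unique stop (step e _ r) <12 =
      contradiction (closed⇒cycle e r) (no-cycle (s≤s⁻¹ <12))
    NB-length-unique {m = suc m} (step e _ r) stop <12 =
      contradiction (closed⇒cycle e r) (no-cycle (≤-trans (≤-reflexive (sym (+-identityʳ _))) (s≤s⁻¹ <12)))
    NB-length-unique {m = suc m} {n = suc n} (step {w = w} e _ r) (step {w = w′} e′ _ s) <12 with w ≟ᶠ w′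
    ... | yes refl = cong suc (NB-length-unique r s (≤-trans (+-monoʳ-≤ (suc m) (n≤1+n n)) (<⇒≤ <12)))
    ... | no w≢w′  = contradiction (diverging⇒cycle e (step e′ (w≢w′ ∘ sym) s) r) (no-cycle (s≤s⁻¹ <12))

    -- Lengths 6 and 6 are the only pair out of reach of `NB-length-unique`, and they agree.
    NB-short-length-unique : ∀ {p p′ x z m n} → NB p x z m → NB p′ x z n → m ≤ 6 → n ≤ 6 → m ≡ n
    NB-short-length-unique {m = m} {n} r s m≤6 n≤6 with m≤n⇒m<n∨m≡n m≤6 | m≤n⇒m<n∨m≡n n≤6
    ... | inj₂ refl | inj₂ refl = refl
    ... | inj₁ m<6  | _         = NB-length-unique r s (+-mono-≤ m<6 n≤6)
    ... | inj₂ refl | inj₁ n<6  = NB-length-unique r s (+-monoʳ-< 6 n<6)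

    neighbour : ∀ u → ∃ (Adj u)
    neighbour u =
      let v , e , _ = M-pos {λ _ → 1} (≤-trans (s≤s z≤n) (≤-reflexive (sym (M-const reg 1 u))))
      in v , e

    extend : ∀ {u v x k} → Adj u v → NB u v x k → NB u u x (suc k)
    extend e = step e (adj-≢ (symm e))

    -- For an edge at `x`, the vertex `z` lies in the tree at `x` or in the tree at the neighbour;
    -- the latter costs one more step.
    reach : ∀ x z → ∃ λ k → k ≤ 6 × ∃ λ p → NB p x z k
    reach x z with neighbour x
    ... | v , e with edge-covers e z
    ...   | inj₁ (k , k≤5 , r) = k , m≤n⇒m≤1+n k≤5 , v , r
    ...   | inj₂ (k , k≤5 , r) = suc k , s≤s k≤5 , x , extend e r

    diameter≤6 : DiameterAtMost6 G
    diameter≤6 x z = let k , k≤6 , _ , r = reach x z in k , k≤6 , NB⇒Walk r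

    root : Vertex
    root = subst Fin (sym size) zero

    -- The length of the walk that `reach` happens to choose; by `NB-distance` every
    -- non-backtracking walk to `root` of length at most 6 has this length.
    distance : Vertex → ℕ
    distance x = proj₁ (reach x root)

    NB-distance : ∀ {p x k} → NB p x root k → k ≤ 6 → distance x ≡ k
    NB-distance {x = x} r k≤6 = let _ , d≤6 , _ , s = reach x root in NB-short-length-unique s r d≤6 k≤6

    -- The root lies in the tree on one side of the edge, and from the other end the walk is longer
    -- by the edge. So adjacent vertices differ in parity, and the graph is bipartite.
    distance-step : ∀ {x y} → Adj x y → distance y ≡ suc (distance x) ⊎ distance x ≡ suc (distance y)
    distance-step {x} {y} e = Sum.map
      (λ (k , k≤5 , r) → trans (NB-distance (extend (symm e) r) (s≤s k≤5))
                               (cong suc (sym (NB-distance r (m≤n⇒m≤1+n k≤5)))))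
      (λ (k , k≤5 , r) → trans (NB-distance (extend e r) (s≤s k≤5))
                               (cong suc (sym (NB-distance r (m≤n⇒m≤1+n k≤5)))))
      (edge-covers e root)

    side : Vertex → Bool
    side x = isEven (distance x)

    side-flip : Alternates G side
    side-flip e = isEven-step (distance-step e)

    no-square : NoSquare G
    no-square {w = w} {w′} u≢x e f e′ f′ = decidable-stable (w ≟ᶠ w′) λ w≢w′ →
      no-cycle (m≤m+n 4 7)
        (diverging⇒cycle e (step e′ (w≢w′ ∘ sym) (step f′ (u≢x ∘ sym) stop)) (step f (u≢x ∘ sym) stop))

    no-hexagon : NoHexagon G
    no-hexagon p₁≢p₂ ℓ₁≢t ℓ₂≢t ℓ₁≢ℓ₂ t₁ t₂ e₁ e₂ f₁ f₂ = no-cycle (m≤m+n 6 5)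
      (closed⇒cycle t₁
        (step e₁ ℓ₁≢t (step f₁ p≢p₁ (step (symm f₂) (ℓ₁≢ℓ₂ ∘ sym) (step (symm e₂) p₂≢p (step (symm t₂) (ℓ₂≢t ∘ sym) stop))))))
      where
      -- If `p` were `p₁`, then `ℓ₂` and `t` would be two common neighbours of `p₁` and `p₂`;
      -- likewise for `p₂` below.
      p≢p₁ : _ ≢ _
      p≢p₁ refl = ℓ₂≢t (no-square p₁≢p₂ (symm f₂) (symm e₂) (symm t₁) t₂)
      p₂≢p : _ ≢ _
      p₂≢p refl = ℓ₁≢t (no-square p₁≢p₂ e₁ f₁ (symm t₁) t₂)

  -- Sizes of separated sets

  module Bipartite {q N : ℕ} (G : Graph) (reg : Graph.IsRegular G (suc q))
    (size : Graph.order G ≡ 2 * N)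
    (side : Graph.Vertex G → Bool)
    (side-flip : Alternates G side) where
    open Graph G
    open Adjacency G
    open Regular reg

    parity-clash : ∀ {u v x} → Adj u v → side x ≡ side u → side x ≡ side v → ⊥
    parity-clash e x~u x~v = not-¬ (trans (sym x~v) x~u) (side-flip e)

    side-2 : ∀ {x w u} → Adj x w → Adj w u → side x ≡ side u
    side-2 {x} e f = sym (trans (side-flip f) (trans (cong not (side-flip e)) (not-involutive (side x))))

    walk₂ : ∀ {u v w} → Adj u v → Adj v w → Walk u w 2
    walk₂ e f = e ∷ (f ∷ [])

    walk₃ : ∀ {u v w x} → Adj u v → Adj v w → Adj w x → Walk u x 3
    walk₃ e f g = e ∷ walk₂ f g

    walk₄ : ∀ {u v w x y} → Adj u v → Adj v w → Adj w x → Adj x y → Walk u y 4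
    walk₄ e f g h = e ∷ walk₃ f g h

    walk₅ : ∀ {u v w x y z} → Adj u v → Adj v w → Adj w x → Adj x y → Adj y z → Walk u z 5
    walk₅ e f g h i = e ∷ walk₄ f g h i

    -- Packing of balls around edges: `B` counts walks from a vertex to members of a set, and `C`
    -- corrects for repetitions. Every vertex lies on equally many edges, so bounds at the edges
    -- average to a bound for half the vertices.
    half-bound : ∀ B C → (∀ {u v} → Adj u v → B u + B v ≤ 1 + (C u + C v)) → ∑ B ≤ N + ∑ C
    half-bound B C h = *-cancelˡ-≤ 2 (begin
      2 * ∑ B          ≤⟨ *-cancelˡ-≤ (suc q) (edge-bound B C h) ⟩
      order + 2 * ∑ C  ≡⟨ cong (_+ 2 * ∑ C) size ⟩
      2 * N + 2 * ∑ C  ≡⟨ *-distribˡ-+ 2 N (∑ C) ⟨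
      2 * (N + ∑ C)    ∎)
      where open ≤-Reasoning

    half-bound-0 : ∀ B → (∀ {u v} → Adj u v → B u + B v ≤ 1) → ∑ B ≤ N
    half-bound-0 B h = ≤-trans (half-bound B (λ _ → 0) (λ e → h e))
      (≤-reflexive (trans (cong (N +_) (trans (sum-const order 0) (*-zeroʳ order))) (+-identityʳ N)))

    module TwoColouring (σ : Vertex → Bool) (σ-flip : Alternates G σ) where

      size≤ : ∣ σ ∣ ≤ N
      size≤ = half-bound-0 (λ x → ⟦ σ x ⟧) λ {u} {v} e → subst (λ b → ⟦ σ u ⟧ + ⟦ b ⟧ ≤ 1) (sym (σ-flip e)) (≤1 (σ u))
        where
        ≤1 : ∀ b → ⟦ b ⟧ + ⟦ not b ⟧ ≤ 1
        ≤1 true  = ≤-refl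
        ≤1 false = ≤-refl

      M-side : ∀ u → M (λ x → ⟦ σ x ⟧) u ≡ suc q * ⟦ not (σ u) ⟧
      M-side u = trans (M-cong λ w e → cong ⟦_⟧ (σ-flip e)) (M-const reg ⟦ not (σ u) ⟧ u)

      -- Double counting of the edges between the sides: a vertex outside `σ` has all its `q + 1`
      -- neighbours in `σ`.
      ∑-side : ∀ g → ∑ (λ u → ⟦ σ u ⟧ * M g u) ≡ suc q * ∑ (λ u → ⟦ not (σ u) ⟧ * g u)
      ∑-side g = begin
        ∑ (λ u → ⟦ σ u ⟧ * M g u)                  ≡⟨ M-adjoint g (λ u → ⟦ σ u ⟧) ⟩
        ∑ (λ u → M (λ x → ⟦ σ x ⟧) u * g u)        ≡⟨ ∑-cong (λ u → cong (_* g u) (M-side u)) ⟩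
        ∑ (λ u → suc q * ⟦ not (σ u) ⟧ * g u)      ≡⟨ ∑-cong (λ u → *-assoc (suc q) ⟦ not (σ u) ⟧ (g u)) ⟩
        ∑ (λ u → suc q * (⟦ not (σ u) ⟧ * g u))    ≡⟨ ∑-*ˡ (suc q) _ ⟩
        suc q * ∑ (λ u → ⟦ not (σ u) ⟧ * g u)      ∎
        where open ≡-Reasoning

    opposite-flip : Alternates G (not ∘ side)
    opposite-flip e = cong not (side-flip e)

    module Side     = TwoColouring side side-flip
    module Opposite = TwoColouring (not ∘ side) opposite-flip

    ∑-split : ∀ g → ∑ g ≡ ∑ (λ u → ⟦ side u ⟧ * g u) + ∑ (λ u → ⟦ not (side u) ⟧ * g u)
    ∑-split g = trans (∑-cong λ u → split (side u) (g u)) (∑-+ (λ u → ⟦ side u ⟧ * g u) _)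
      where
      split : ∀ b n → n ≡ ⟦ b ⟧ * n + ⟦ not b ⟧ * n
      split true  n = sym (trans (+-identityʳ _) (+-identityʳ n))
      split false n = sym (+-identityʳ n)

    sides-sum : ∣ side ∣ + ∣ not ∘ side ∣ ≡ N + N
    sides-sum = begin
      ∣ side ∣ + ∣ not ∘ side ∣
        ≡⟨ cong₂ _+_ (∑-cong λ u → sym (*-identityʳ _)) (∑-cong λ u → sym (*-identityʳ _)) ⟩
      ∑ (λ u → ⟦ side u ⟧ * 1) + ∑ (λ u → ⟦ not (side u) ⟧ * 1)  ≡⟨ ∑-split (λ _ → 1) ⟨
      ∑ (λ _ → 1)  ≡⟨ ∑-1 ⟩
      order        ≡⟨ size ⟩
      N + (N + 0)  ≡⟨ cong (N +_) (+-identityʳ N) ⟩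
      N + N        ∎
      where open ≡-Reasoning

    -- Neither side exceeds `N`, and together they have `2 * N` vertices.
    opposite-size : ∣ not ∘ side ∣ ≡ N
    opposite-size = ≤-antisym Opposite.size≤
      (+-cancelˡ-≤ N _ _ (≤-trans (≤-reflexive (sym sides-sum)) (+-monoˡ-≤ _ Side.size≤)))

    -- Bounds for separated sets from disjoint balls

    module Codes (no-square : NoSquare G)
      (f : Vertex → Bool) where

      φ : Vertex → ℕ
      φ x = ⟦ f x ⟧

      -- Distance greater than `r` between distinct members, phrased with walks: exhibiting any
      -- short walk suffices to identify two members.
      Separated : ℕ → Set
      Separated r = ∀ {x y m} → f x ≡ true → f y ≡ true → m ≤ r → Walk x y m → x ≡ y

      weaken : ∀ {r s} → s ≤ r → Separated r → Separated s
      weaken s≤r sep fx fy m≤s = sep fx fy (≤-trans m≤s s≤r)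

      neighbour-in : ∀ {u} → 0 < M φ u → ∃ λ w → Adj u w × f w ≡ true
      neighbour-in pos = let w , e , p = M-pos pos in w , e , ⟦⟧-pos p

      second-neighbour-in : ∀ {u} → 0 < M (M φ) u → ∃₂ λ w x → Adj u w × Adj w x × f x ≡ true
      second-neighbour-in pos =
        let w , e , p = M-pos pos
            x , e′ , fx = neighbour-in p
        in w , x , e , e′ , fx

      Mφ≤1 : Separated 2 → ∀ u → M φ u ≤ 1
      Mφ≤1 sep u = M-unique (λ w _ → ⟦⟧≤1 (f w))
        λ w w′ e e′ p p′ → sep (⟦⟧-pos p) (⟦⟧-pos p′) ≤-refl (walk₂ (symm e) e′)

      -- From a member each of the `q + 1` neighbours leads only back to it, hence `1 + q`. From
      -- another vertex at most one member is reached in two steps, and `NoSquare` leaves a single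
      -- walk to it.
      MMφ≤ : Separated 4 → ∀ u → M (M φ) u ≤ 1 + q * φ u
      MMφ≤ sep u = by-cases (f u) refl
        where
        by-cases : ∀ b → f u ≡ b → M (M φ) u ≤ 1 + q * ⟦ b ⟧
        by-cases true  _ = ≤-trans (M-mono λ w _ → Mφ≤1 (weaken (m≤m+n 2 2) sep) w) (≤-reflexive (M-const reg 1 u))
        by-cases false fu = ≤-trans
          (M-unique (λ w _ → Mφ≤1 (weaken (m≤m+n 2 2) sep) w) λ w w′ e e′ p p′ →
            let x , g , fx = neighbour-in p
                x′ , g′ , fx′ = neighbour-in p′
                x′≡x = sep fx′ fx ≤-refl (walk₄ (symm g′) (symm e′) e g)
            in no-square (λ u≡x → contradiction (trans (sym fu) (trans (cong f u≡x) fx)) λ ())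
                 e g e′ (subst (Adj w′) x′≡x g′))
          (m≤m+n 1 _)

      independent-bound : Separated 1 → ∣ f ∣ ≤ N
      independent-bound sep = half-bound-0 φ λ {u} {v} e →
        exclusive-sum≤ (⟦⟧≤1 (f u)) (⟦⟧≤1 (f v)) λ p p′ →
          adj-≢ e (sep (⟦⟧-pos p) (⟦⟧-pos p′) ≤-refl (e ∷ []))

      -- The balls of radius 1 around members are disjoint and have `q + 2` vertices each.
      separated-2-bound : Separated 2 → ∣ f ∣ * (q + 2) ≤ 2 * N
      separated-2-bound sep = begin
        ∣ f ∣ * (q + 2)          ≡⟨ trans (*-comm ∣ f ∣ (q + 2)) (cong (_* ∣ f ∣) (+-comm q 2)) ⟩
        ∣ f ∣ + suc q * ∣ f ∣    ≡⟨ cong (∣ f ∣ +_) (sum-M φ) ⟨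
        ∣ f ∣ + ∑ (M φ)          ≡⟨ ∑-+ φ (M φ) ⟨
        ∑ (λ u → φ u + M φ u)    ≤⟨ ∑-mono (λ u → exclusive-sum≤ (⟦⟧≤1 (f u)) (Mφ≤1 sep u) λ p p′ →
                                      let w , e , fw = neighbour-in p′
                                      in adj-≢ e (sep (⟦⟧-pos p) fw (s≤s z≤n) (e ∷ []))) ⟩
        ∑ (λ _ → 1)              ≡⟨ ∑-1 ⟩
        order                    ≡⟨ size ⟩
        2 * N                    ∎
        where open ≤-Reasoning

      -- Members next to the two ends of an edge are joined by three steps, hence equal; but by
      -- parity no vertex is adjacent to both ends.
      separated-3-bound : Separated 3 → suc q * ∣ f ∣ ≤ N
      separated-3-bound sep = ≤-trans (≤-reflexive (sym (sum-M φ)))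
        (half-bound-0 (M φ) λ {u} {v} e → exclusive-sum≤ (Mφ≤1 sep₂ u) (Mφ≤1 sep₂ v) λ p p′ →
          let x , g , fx = neighbour-in p
              y , h , fy = neighbour-in p′
              x≡y = sep fx fy ≤-refl (walk₃ (symm g) e h)
          in parity-clash {x = x} e (trans (cong side x≡y) (sym (side-2 e h))) (side-2 (symm g) e))
        where
        sep₂ : Separated 2
        sep₂ = weaken (m≤m+n 2 1) sep

      -- Balls of radius 2 around the vertices of one side only. A member on the other side is met
      -- by `q + 1` of them; one on the same side is reached by `(q + 1)²` walks of length 2, and
      -- the term with `q` on the right makes up for its `q + 1` walks back to itself.
      separated-4-bound : Separated 4 → ∀ σ → Alternates G σ →
        suc q * ∑ (λ u → ⟦ not (σ u) ⟧ * φ u) + suc q * (suc q * ∑ (λ u → ⟦ σ u ⟧ * φ u))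
          ≤ N + q * ∑ (λ u → ⟦ σ u ⟧ * φ u)
      separated-4-bound sep σ σ-flip = begin
        suc q * ∑ (λ u → ⟦ not (σ u) ⟧ * φ u) + suc q * (suc q * ∑ (λ u → ⟦ σ u ⟧ * φ u))
          ≡⟨ cong (λ s → suc q * ∑ (λ u → ⟦ not (σ u) ⟧ * φ u) + suc q * (suc q * s))
               (∑-cong λ u → cong (λ b → ⟦ b ⟧ * φ u) (sym (not-involutive (σ u)))) ⟩
        suc q * ∑ (λ u → ⟦ not (σ u) ⟧ * φ u) + suc q * (suc q * ∑ (λ u → ⟦ not (not (σ u)) ⟧ * φ u))
          ≡⟨ cong₂ _+_ (S.∑-side φ) (trans (S.∑-side (M φ)) (cong (suc q *_) (S′.∑-side φ))) ⟨
        ∑ (λ u → ⟦ σ u ⟧ * M φ u) + ∑ (λ u → ⟦ σ u ⟧ * M (M φ) u)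
          ≡⟨ ∑-+ (λ u → ⟦ σ u ⟧ * M φ u) _ ⟨
        ∑ (λ u → ⟦ σ u ⟧ * M φ u + ⟦ σ u ⟧ * M (M φ) u)
          ≤⟨ ∑-mono (λ u → ≤-trans (≤-reflexive (sym (*-distribˡ-+ ⟦ σ u ⟧ (M φ u) _))) (*-monoʳ-≤ ⟦ σ u ⟧ (ball u))) ⟩
        ∑ (λ u → ⟦ σ u ⟧ * (1 + q * φ u))
          ≡⟨ ∑-cong (λ u → expand ⟦ σ u ⟧ q (φ u)) ⟩
        ∑ (λ u → ⟦ σ u ⟧ + q * (⟦ σ u ⟧ * φ u))
          ≡⟨ trans (∑-+ (λ u → ⟦ σ u ⟧) _) (cong (∣ σ ∣ +_) (∑-*ˡ q _)) ⟩
        ∣ σ ∣ + q * ∑ (λ u → ⟦ σ u ⟧ * φ u)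
          ≤⟨ +-monoˡ-≤ _ S.size≤ ⟩
        N + q * ∑ (λ u → ⟦ σ u ⟧ * φ u) ∎
        where
        open ≤-Reasoning
        module S  = TwoColouring σ σ-flip
        module S′ = TwoColouring (not ∘ σ) (cong not ∘ σ-flip)
        expand : ∀ s q x → s * (1 + q * x) ≡ s + q * (s * x)
        expand = solve-∀
        -- A member next to `u` and one two steps away would be joined by three steps, hence equal,
        -- yet they lie on different sides.
        ball : ∀ u → M φ u + M (M φ) u ≤ 1 + q * φ u
        ball u = exclusive-sum≤ (≤-trans (Mφ≤1 (weaken (m≤m+n 2 2) sep) u) (m≤m+n 1 _)) (MMφ≤ sep u) λ p p′ →
          let x , e , fx = neighbour-in p
              w , y , g , h , fy = second-neighbour-in p′
              x≡y = sep fx fy (m≤m+n 3 1) (walk₃ (symm e) g h)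
          in parity-clash {x = x} e (trans (cong side x≡y) (sym (side-2 g h))) refl

      -- The balls of radius 2 are now around edges: members two steps from the two ends would be
      -- joined by five steps, yet lie on different sides.
      separated-5-bound : Separated 5 → suc q * (suc q * ∣ f ∣) ≤ N + q * ∣ f ∣
      separated-5-bound sep = begin
        suc q * (suc q * ∣ f ∣)    ≡⟨ trans (sum-M (M φ)) (cong (suc q *_) (sum-M φ)) ⟨
        ∑ (M (M φ))                ≤⟨ half-bound (M (M φ)) (λ u → q * φ u) edge ⟩
        N + ∑ (λ u → q * φ u)      ≡⟨ cong (N +_) (∑-*ˡ q φ) ⟩
        N + q * ∣ f ∣              ∎
        where
        open ≤-Reasoning
        sep₄ : Separated 4
        sep₄ = weaken (m≤m+n 4 1) sep
        edge : ∀ {u v} → Adj u v → M (M φ) u + M (M φ) v ≤ 1 + (q * φ u + q * φ v)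
        edge {u} {v} e = exclusive-sum≤
          (≤-trans (MMφ≤ sep₄ u) (+-monoʳ-≤ 1 (m≤m+n _ _)))
          (≤-trans (MMφ≤ sep₄ v) (+-monoʳ-≤ 1 (m≤n+m _ _))) λ p p′ →
            let w , x , g , h , fx = second-neighbour-in p
                w′ , y , g′ , h′ , fy = second-neighbour-in p′
                x≡y = sep fx fy ≤-refl (walk₅ (symm h) (symm g) e g′ h′)
            in parity-clash {x = x} e (sym (side-2 g h)) (trans (cong side x≡y) (sym (side-2 g′ h′)))

      separated-6-bound : DiameterAtMost6 G → Separated 6 → ∣ f ∣ ≤ 1
      separated-6-bound diameter≤6 sep = sum-unique φ (λ x → ⟦⟧≤1 (f x)) λ x y p p′ →
        let m , m≤6 , W = diameter≤6 x y in sep (⟦⟧-pos p) (⟦⟧-pos p′) m≤6 W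

  -- Large independent sets of lines and the colouring

  module PartialSpreads {q : ℕ} (q>0 : 0 < q) (G : Graph) (reg : Graph.IsRegular G (suc q))
    (no-square : NoSquare G) (no-hexagon : NoHexagon G) where
    open Graph G
    open Adjacency G
    open Regular reg

    M-lower : ∀ {f u w} → Adj u w → f w ≤ M f u
    M-lower {f} {u} {w} e = ≤-trans
      (≤-reflexive (sym (trans (cong (_* f w) (a-adj e)) (+-identityʳ (f w))))) (term≤sum (λ w → a u w * f w) w)

    insert : Vertex → Subset → Subset
    insert x τ y = does (y ≟ᶠ x) ∨ τ y

    remove : Vertex → Subset → Subset
    remove x τ y = not (does (y ≟ᶠ x)) ∧ τ y

    ∈-insert : ∀ x τ y → insert x τ y ≡ true → y ≡ x ⊎ τ y ≡ true
    ∈-insert x τ y p with y ≟ᶠ x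
    ... | yes y≡x = inj₁ y≡x
    ... | no _    = inj₂ p

    ∈-remove : ∀ x τ y → remove x τ y ≡ true → y ≢ x × τ y ≡ true
    ∈-remove x τ y p with y ≟ᶠ x
    ... | no y≢x = y≢x , p

    ∣insert∣ : ∀ {x τ} → ¬ τ x ≡ true → suc ∣ τ ∣ ≤ ∣ insert x τ ∣
    ∣insert∣ {x} {τ} x∉τ = begin
      suc ∣ τ ∣                                  ≡⟨ cong (_+ ∣ τ ∣) (sum-δ-1 x) ⟨
      ∑ (λ y → ⟦ does (y ≟ᶠ x) ⟧) + ∣ τ ∣        ≡⟨ ∑-+ (λ y → ⟦ does (y ≟ᶠ x) ⟧) _ ⟨
      ∑ (λ y → ⟦ does (y ≟ᶠ x) ⟧ + ⟦ τ y ⟧)      ≤⟨ ∑-mono pointwise ⟩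
      ∣ insert x τ ∣                             ∎
      where
      open ≤-Reasoning
      pointwise : ∀ y → ⟦ does (y ≟ᶠ x) ⟧ + ⟦ τ y ⟧ ≤ ⟦ insert x τ y ⟧
      pointwise y with y ≟ᶠ x | τ y in y∈τ
      ... | yes refl | true  = contradiction y∈τ x∉τ
      ... | yes _    | false = ≤-refl
      ... | no _     | _     = ≤-refl

    ∣remove∣ : ∀ x τ → ∣ τ ∣ ≤ suc ∣ remove x τ ∣
    ∣remove∣ x τ = begin
      ∣ τ ∣                                              ≤⟨ ∑-mono (λ y → pointwise (does (y ≟ᶠ x)) (τ y)) ⟩
      ∑ (λ y → ⟦ does (y ≟ᶠ x) ⟧ + ⟦ remove x τ y ⟧)     ≡⟨ ∑-+ (λ y → ⟦ does (y ≟ᶠ x) ⟧) _ ⟩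
      ∑ (λ y → ⟦ does (y ≟ᶠ x) ⟧) + ∣ remove x τ ∣       ≡⟨ cong (_+ ∣ remove x τ ∣) (sum-δ-1 x) ⟩
      suc ∣ remove x τ ∣                                 ∎
      where
      open ≤-Reasoning
      pointwise : ∀ b c → ⟦ c ⟧ ≤ ⟦ b ⟧ + ⟦ not b ∧ c ⟧
      pointwise true  c = ≤-trans (⟦⟧≤1 c) (m≤m+n 1 0)
      pointwise false c = ≤-refl

    -- For a set of lines of the hexagon: pairwise disjoint.
    Independent : Subset → Set
    Independent τ = ∀ {x y p} → τ x ≡ true → τ y ≡ true → Adj x p → Adj y p → x ≡ y

    IndependentIn : Subset → Subset → Set
    IndependentIn U τ = (∀ {x} → τ x ≡ true → U x ≡ true) × Independent τ

    Maximum : Subset → Subset → Set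
    Maximum U τ = ∀ τ′ → IndependentIn U τ′ → ∣ τ′ ∣ ≤ ∣ τ ∣

    insert-independent : ∀ {U x τ} → U x ≡ true →
      (∀ {y p} → τ y ≡ true → Adj x p → Adj y p → ⊥) →
      IndependentIn U τ → IndependentIn U (insert x τ)
    insert-independent {U} {x} {τ} Ux apart (τ⊆U , ind) = inside , independent
      where
      inside : ∀ {y} → insert x τ y ≡ true → U y ≡ true
      inside {y} y∈ with ∈-insert x τ y y∈
      ... | inj₁ refl = Ux
      ... | inj₂ y∈τ  = τ⊆U y∈τ
      independent : Independent (insert x τ)
      independent {y} {z} y∈ z∈ e f with ∈-insert x τ y y∈ | ∈-insert x τ z z∈
      ... | inj₁ refl | inj₁ refl = refl
      ... | inj₁ refl | inj₂ z∈τ  = ⊥-elim (apart z∈τ e f)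
      ... | inj₂ y∈τ  | inj₁ refl = ⊥-elim (apart y∈τ f e)
      ... | inj₂ y∈τ  | inj₂ z∈τ  = ind y∈τ z∈τ e f

    remove-independent : ∀ {U x τ} → IndependentIn U τ → IndependentIn U (remove x τ)
    remove-independent {x = x} {τ} (τ⊆U , ind) =
      (λ {y} y∈ → τ⊆U (kept y y∈)) , λ {y} {z} y∈ z∈ → ind (kept y y∈) (kept z z∈)
      where
      kept : ∀ y → remove x τ y ≡ true → τ y ≡ true
      kept y y∈ = proj₂ (∈-remove x τ y y∈)

    -- Double negation avoids deciding the existence of larger sets; the inequality
    -- finally derived from a maximum set is decidable.
    ¬¬maximum : ∀ U → ¬ ¬ ∃ λ τ → IndependentIn U τ × Maximum U τ
    ¬¬maximum U none = climb order (λ _ → false) ((λ ()) , λ ()) (m≤n+m _ _)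
      where
      -- `n` bounds how often the size can still increase, since no set has more than `order`
      -- elements.
      climb : ∀ n τ → IndependentIn U τ → order ≤ ∣ τ ∣ + n → ⊥
      climb n τ ind order≤ = none (τ , ind , λ τ′ ind′ → ≮⇒≥ (larger n order≤ τ′ ind′))
        where
        larger : ∀ n → order ≤ ∣ τ ∣ + n → ∀ τ′ → IndependentIn U τ′ → ¬ ∣ τ ∣ < ∣ τ′ ∣
        larger zero order≤ τ′ _ τ<τ′ = <⇒≱ (≤-trans (s≤s order≤) (≤-trans (≤-reflexive (cong suc (+-identityʳ _))) τ<τ′))
          (≤-trans (∑-mono λ x → ⟦⟧≤1 (τ′ x)) (≤-reflexive ∑-1))
        larger (suc n) order≤ τ′ ind′ τ<τ′ = climb n τ′ ind′
          (≤-trans order≤ (≤-trans (≤-reflexive (+-suc _ n)) (+-monoˡ-≤ n τ<τ′)))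

    module MaximumSpread {U τ : Subset} (ind : IndependentIn U τ) (maximum : Maximum U τ) where

      t : Vertex → ℕ
      t x = ⟦ τ x ⟧

      -- The number of members of τ meeting a line outside τ.
      contacts : Vertex → ℕ
      contacts = M (M t)

      private-line : Vertex → ℕ
      private-line ℓ = ⟦ U ℓ ∧ not (τ ℓ) ∧ does (contacts ℓ ≟ 1) ⟧

      private-elim : ∀ {ℓ} → 0 < private-line ℓ → U ℓ ≡ true × τ ℓ ≡ false × contacts ℓ ≡ 1
      private-elim {ℓ} pos = elim (U ℓ) (τ ℓ) (contacts ℓ ≟ 1) pos
        where
        elim : ∀ {A : Set} u b (d : Dec A) → 0 < ⟦ u ∧ not b ∧ does d ⟧ → u ≡ true × b ≡ false × A
        elim true false (yes x) _ = refl , refl , x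

      contact : ∀ {ℓ p y} → τ y ≡ true → Adj ℓ p → Adj p y → 1 ≤ a ℓ p * M t p
      contact {p = p} {y} τy e f = *-mono-≤ (≤-reflexive (sym (a-adj e)))
        (≤-trans (≤-reflexive (sym (cong ⟦_⟧ τy))) (M-lower f))

      -- Two different points of contact would add 2 to `contacts`; at a common point the
      -- independence of `τ` applies.
      unique-contact : ∀ {ℓ p p′ y y′} → contacts ℓ ≡ 1 → τ y ≡ true → τ y′ ≡ true →
        Adj ℓ p → Adj p y → Adj ℓ p′ → Adj p′ y′ → y ≡ y′
      unique-contact {ℓ} {p} {p′} one τy τy′ e f e′ f′ with p ≟ᶠ p′
      ... | yes refl = proj₂ ind τy τy′ (symm f) (symm f′)
      ... | no p≢p′  = contradiction one (>⇒≢ (≤-trans (+-mono-≤ (contact τy e f) (contact τy′ e′ f′))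
                         (two-terms≤sum (λ w → a ℓ w * M t w) p≢p′)))

      -- A member meets itself at each of its `q + 1` points.
      members-touch : ∀ {x} → τ x ≡ true → 2 ≤ contacts x
      members-touch {x} τx = begin
        2                ≤⟨ s≤s q>0 ⟩
        suc q            ≡⟨ trans (M-const reg 1 x) (*-identityʳ (suc q)) ⟨
        M (λ _ → 1) x    ≤⟨ M-mono (λ w e → ≤-trans (≤-reflexive (sym (cong ⟦_⟧ τx))) (M-lower (symm e))) ⟩
        contacts x       ∎
        where open ≤-Reasoning

      -- By maximality: a line of `U` meeting no member could be added.
      others-touch : ∀ {x} → U x ≡ true → τ x ≡ false → 0 < contacts x
      others-touch {x} Ux τx with pos-or-zero (contacts x)
      ... | inj₁ pos = pos
      ... | inj₂ none = contradiction (maximum (insert x τ) (insert-independent Ux apart ind))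
                          (<⇒≱ (∣insert∣ {τ = τ} λ x∈τ → contradiction (trans (sym x∈τ) τx) λ ()))
        where
        apart : ∀ {y p} → τ y ≡ true → Adj x p → Adj y p → ⊥
        apart {p = p} τy e f = n≮0 (≤-trans (≤-trans (contact τy e (symm f)) (term≤sum (λ w → a x w * M t w) p)) (≤-reflexive none))

      -- Every line of `U` is to be covered twice; a line outside `τ` with a single contact gets its
      -- second unit from `private-line`.
      covered : ∀ x → 2 * ⟦ U x ⟧ ≤ contacts x + private-line x
      covered x = cover (U x) (τ x) (contacts x) (λ _ → members-touch) others-touch
        where
        cover : ∀ u b n → (u ≡ true → b ≡ true → 2 ≤ n) → (u ≡ true → b ≡ false → 0 < n) →
          2 * ⟦ u ⟧ ≤ n + ⟦ u ∧ not b ∧ does (n ≟ 1) ⟧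
        cover false b n             _    _   = z≤n
        cover true  true  n         many _   = ≤-trans (many refl refl) (m≤m+n n _)
        cover true  false zero      _    one = contradiction (one refl refl) λ ()
        cover true  false (suc zero) _   _   = ≤-refl
        cover true  false (suc (suc n)) _ _  = s≤s (s≤s z≤n)

      -- Otherwise t could be exchanged for two private lines through different
      -- points of t.
      private-through-one-point : ∀ {x} → τ x ≡ true → M (M private-line) x ≤ suc q
      private-through-one-point {x} τx = M-unique
        (λ p _ → ≤-trans (M-mono λ ℓ _ → ⟦⟧≤1 _) (≤-reflexive (trans (M-const reg 1 p) (*-identityʳ (suc q)))))
        λ p₁ p₂ e₁ e₂ pos₁ pos₂ → decidable-stable (p₁ ≟ᶠ p₂) λ p₁≢p₂ →
          let ℓ₁ , f₁ , priv₁ = M-pos pos₁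
              ℓ₂ , f₂ , priv₂ = M-pos pos₂
          in exchange p₁≢p₂ e₁ e₂ f₁ f₂ (private-elim priv₁) (private-elim priv₂)
        where
        exchange : ∀ {p₁ p₂ ℓ₁ ℓ₂} → p₁ ≢ p₂ → Adj x p₁ → Adj x p₂ → Adj p₁ ℓ₁ → Adj p₂ ℓ₂ →
          U ℓ₁ ≡ true × τ ℓ₁ ≡ false × contacts ℓ₁ ≡ 1 →
          U ℓ₂ ≡ true × τ ℓ₂ ≡ false × contacts ℓ₂ ≡ 1 → ⊥
        exchange {p₁} {p₂} {ℓ₁} {ℓ₂} p₁≢p₂ e₁ e₂ f₁ f₂ (Uℓ₁ , τℓ₁ , one₁) (Uℓ₂ , τℓ₂ , one₂) =
          <⇒≱ larger (maximum τ₂ (insert-independent Uℓ₂ apart₂ (insert-independent Uℓ₁ apart₁ (remove-independent ind))))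
          where
          τ₀ τ₁ τ₂ : Subset
          τ₀ = remove x τ
          τ₁ = insert ℓ₁ τ₀
          τ₂ = insert ℓ₂ τ₁
          outside : ∀ {ℓ} → τ ℓ ≡ false → ¬ τ ℓ ≡ true
          outside p q = contradiction (trans (sym q) p) λ ()
          ≢x : ∀ {ℓ} → τ ℓ ≡ false → ℓ ≢ x
          ≢x τℓ refl = outside τℓ τx
          ℓ₁≢ℓ₂ : ℓ₁ ≢ ℓ₂
          ℓ₁≢ℓ₂ refl = ≢x τℓ₁ (no-square p₁≢p₂ f₁ (symm f₂) (symm e₁) e₂)
          -- The only member that `ℓ₁` meets is `x`, which has been removed.
          apart₁ : ∀ {y p} → τ₀ y ≡ true → Adj ℓ₁ p → Adj y p → ⊥
          apart₁ {y} y∈ g h = let y≢x , τy = ∈-remove x τ y y∈ in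
            y≢x (unique-contact one₁ τy τx g (symm h) (symm f₁) (symm e₁))
          apart₂ : ∀ {y p} → τ₁ y ≡ true → Adj ℓ₂ p → Adj y p → ⊥
          apart₂ {y} y∈ g h with ∈-insert ℓ₁ τ₀ y y∈
          -- `ℓ₁` and `ℓ₂` cannot meet, because with `x` they would form a triangle.
          ... | inj₁ refl = no-hexagon p₁≢p₂ (≢x τℓ₁) (≢x τℓ₂) ℓ₁≢ℓ₂ e₁ e₂ f₁ f₂ h g
          ... | inj₂ y∈τ₀ = let y≢x , τy = ∈-remove x τ y y∈τ₀ in
            y≢x (unique-contact one₂ τy τx g (symm h) (symm f₂) (symm e₂))
          ℓ₁∉τ₀ : ¬ τ₀ ℓ₁ ≡ true
          ℓ₁∉τ₀ = outside τℓ₁ ∘ proj₂ ∘ ∈-remove x τ ℓ₁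
          ℓ₂∉τ₁ : ¬ τ₁ ℓ₂ ≡ true
          ℓ₂∉τ₁ ℓ₂∈ with ∈-insert ℓ₁ τ₀ ℓ₂ ℓ₂∈
          ... | inj₁ ℓ₂≡ℓ₁ = ℓ₁≢ℓ₂ (sym ℓ₂≡ℓ₁)
          ... | inj₂ ℓ₂∈τ₀ = outside τℓ₂ (proj₂ (∈-remove x τ ℓ₂ ℓ₂∈τ₀))
          larger : ∣ τ ∣ < ∣ τ₂ ∣
          larger = ≤-trans (s≤s (∣remove∣ x τ)) (≤-trans (s≤s (∣insert∣ {τ = τ₀} ℓ₁∉τ₀)) (∣insert∣ {τ = τ₁} ℓ₂∉τ₁))

      -- Counts pairs of a private line and a member meeting it: the line has exactly one contact,
      -- and the member meets at most `q + 1` private lines.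
      private-count : ∑ private-line ≤ suc q * ∣ τ ∣
      private-count = begin
        ∑ private-line                              ≤⟨ ∑-mono weigh ⟩
        ∑ (λ x → private-line x * M (M t) x)        ≡⟨ M-adjoint (M t) private-line ⟩
        ∑ (λ x → M private-line x * M t x)          ≡⟨ M-adjoint t (M private-line) ⟩
        ∑ (λ x → M (M private-line) x * t x)
          ≤⟨ ∑-mono (λ x → at-members (τ x) private-through-one-point) ⟩
        ∑ (λ x → suc q * t x)                       ≡⟨ ∑-*ˡ (suc q) t ⟩
        suc q * ∣ τ ∣                               ∎
        where
        open ≤-Reasoning
        weigh : ∀ x → private-line x ≤ private-line x * M (M t) x
        weigh x with pos-or-zero (private-line x)
        ... | inj₁ pos  = ≤-reflexive (sym (trans (cong (private-line x *_) (proj₂ (proj₂ (private-elim pos)))) (*-identityʳ _)))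
        ... | inj₂ none = ≤-trans (≤-reflexive none) z≤n
        at-members : ∀ {m n} b → (b ≡ true → m ≤ n) → m * ⟦ b ⟧ ≤ n * ⟦ b ⟧
        at-members     true  m≤n = *-monoˡ-≤ 1 (m≤n refl)
        at-members {m} false _   = ≤-trans (≤-reflexive (*-zeroʳ m)) z≤n

      -- Each member accounts for `(q + 1)²` contacts and at most `q + 1` private lines, in sum
      -- `(q + 1) (q + 2)`, and this covers every line of `U` twice.
      maximum-size : 2 * ∣ U ∣ ≤ suc q * suc (suc q) * ∣ τ ∣
      maximum-size = begin
        2 * ∣ U ∣                                    ≡⟨ ∑-*ˡ 2 (λ x → ⟦ U x ⟧) ⟨
        ∑ (λ x → 2 * ⟦ U x ⟧)                        ≤⟨ ∑-mono covered ⟩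
        ∑ (λ x → contacts x + private-line x)        ≡⟨ ∑-+ contacts private-line ⟩
        ∑ contacts + ∑ private-line                  ≤⟨ +-monoʳ-≤ (∑ contacts) private-count ⟩
        ∑ contacts + suc q * ∣ τ ∣
          ≡⟨ cong (_+ suc q * ∣ τ ∣) (trans (sum-M (M t)) (cong (suc q *_) (sum-M t))) ⟩
        suc q * (suc q * ∣ τ ∣) + suc q * ∣ τ ∣      ≡⟨ collect q ∣ τ ∣ ⟩
        suc q * suc (suc q) * ∣ τ ∣                  ∎
        where
        open ≤-Reasoning
        collect : ∀ q s → suc q * (suc q * s) + suc q * s ≡ suc q * suc (suc q) * s
        collect = solve-∀

    ¬¬large-independent : ∀ U → ¬ ¬ ∃ λ τ → IndependentIn U τ × 2 * ∣ U ∣ ≤ suc q * suc (suc q) * ∣ τ ∣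
    ¬¬large-independent U none = ¬¬maximum U λ (τ , ind , maximum) →
      none (τ , ind , MaximumSpread.maximum-size ind maximum)

    -- The colouring built from two partial spreads

    module Colouring {N : ℕ} (side : Vertex → Bool) (side-flip : Alternates G side)
      (lines : ∣ not ∘ side ∣ ≡ N) (S₁ S₂ : Subset)
      (ind₁ : IndependentIn (not ∘ side) S₁)
      (ind₂ : IndependentIn (λ x → not (side x) ∧ not (S₁ x)) S₂) where

      leftover : Subset
      leftover x = not (side x) ∧ not (S₁ x) ∧ not (S₂ x)

      leftovers : List Vertex
      leftovers = filter (T? ∘ leftover) (allFin order)

      data Class (x : Vertex) : Set where
        point  : side x ≡ true → Class x
        first  : S₁ x ≡ true → Class x
        second : S₂ x ≡ true → Class x
        single : x ∈ leftovers → Class x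

      classify : ∀ x → Class x
      classify x = from (side x) (S₁ x) (S₂ x) refl refl refl
        where
        from : ∀ b c d → side x ≡ b → S₁ x ≡ c → S₂ x ≡ d → Class x
        from true  _     _     p _  _  = point p
        from false true  _     _ p  _  = first p
        from false false true  _ _  p  = second p
        from false false false p p′ p″ = single (∈-filter⁺ (T? ∘ leftover) (∈-allFin x) alone)
          where
          alone : T (leftover x)
          alone rewrite p | p′ | p″ = _

      toColour : ∀ {x} → Class x → Fin (3 + length leftovers)
      toColour (point _)   = zero
      toColour (first _)   = suc zero
      toColour (second _)  = suc (suc zero)
      toColour (single x∈) = suc (suc (suc (index x∈)))

      line₁ : ∀ {x} → S₁ x ≡ true → not (side x) ≡ true
      line₁ = proj₁ ind₁

      line₂ : ∀ {x} → S₂ x ≡ true → not (side x) ≡ true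
      line₂ {x} x∈ = go (side x) (proj₁ ind₂ x∈)
        where
        go : ∀ b {c} → not b ∧ c ≡ true → not b ≡ true
        go false _ = refl

      -- Walks of length 1 or 3 change sides, and lines of `S₁` or of `S₂` joined by two steps would
      -- meet. So colours 1, 2 and 3 keep the distances 2, 3 and 4; every further colour occurs at
      -- most once.
      far : ∀ {u v} → u ≢ v → (c : Class u) (d : Class v) → toColour c ≡ toColour d →
        ∀ m → Walk u v m → colour (toColour c) + 1 ≤ m
      far u≢v (point p) (point p′) _ zero [] = contradiction refl u≢v
      far u≢v (point p) (point p′) _ (suc zero) (e ∷ []) =
        contradiction (trans (sym p′) (trans (side-flip e) (cong not p))) λ ()
      far u≢v (point p) (point p′) _ (suc (suc m)) _ = s≤s (s≤s z≤n)
      far u≢v (first p) (first p′) _ zero [] = contradiction refl u≢v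
      far u≢v (first p) (first p′) _ (suc zero) (e ∷ []) = 
        contradiction (trans (sym (line₁ p′)) (cong not (trans (side-flip e) (line₁ p)))) λ ()
      far u≢v (first p) (first p′) _ (suc (suc zero)) (e ∷ (f ∷ [])) = contradiction (proj₂ ind₁ p p′ e (symm f)) u≢v
      far u≢v (first p) (first p′) _ (suc (suc (suc m))) _ = s≤s (s≤s (s≤s z≤n))
      far u≢v (second p) (second p′) _ zero [] = contradiction refl u≢v
      far u≢v (second p) (second p′) _ (suc zero) (e ∷ []) =
        contradiction (trans (sym (line₂ p′)) (cong not (trans (side-flip e) (line₂ p)))) λ ()
      far u≢v (second p) (second p′) _ (suc (suc zero)) (e ∷ (f ∷ [])) = contradiction (proj₂ ind₂ p p′ e (symm f)) u≢v
      far u≢v (second p) (second p′) _ (suc (suc (suc zero))) (e ∷ (f ∷ (g ∷ []))) =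
        contradiction
          (trans (sym (line₂ p′))
            (cong not (trans (side-flip g) (cong not (trans (side-flip f) (cong not (trans (side-flip e) (line₂ p))))))))
          λ ()
      far u≢v (second p) (second p′) _ (suc (suc (suc (suc m)))) _ = s≤s (s≤s (s≤s (s≤s z≤n)))
      far u≢v (single p) (single p′) same _ _ =
        contradiction (trans (lookup-index p) (trans (cong (lookup leftovers) index≡) (sym (lookup-index p′)))) u≢v
        where
        index≡ : index p ≡ index p′
        index≡ = suc-injective (suc-injective (suc-injective same))

      colourable : PackingColourable (3 + length leftovers)
      colourable = toColour ∘ classify , λ u v u≢v same d (W , _) → far u≢v (classify u) (classify v) same d W

      leftovers-count : length leftovers + (∣ S₁ ∣ + ∣ S₂ ∣) ≡ N
      leftovers-count = begin
        length leftovers + (∣ S₁ ∣ + ∣ S₂ ∣)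
          ≡⟨ cong₂ _+_ (length-filter (T? ∘ leftover) id) (sym (∑-+ (λ x → ⟦ S₁ x ⟧) _)) ⟩
        ∣ leftover ∣ + ∑ (λ x → ⟦ S₁ x ⟧ + ⟦ S₂ x ⟧)             ≡⟨ ∑-+ (λ x → ⟦ leftover x ⟧) _ ⟨
        ∑ (λ x → ⟦ leftover x ⟧ + (⟦ S₁ x ⟧ + ⟦ S₂ x ⟧))
          ≡⟨ ∑-cong (λ x → count (side x) (S₁ x) (S₂ x) (proj₁ ind₁) (proj₁ ind₂)) ⟩
        ∣ not ∘ side ∣                                           ≡⟨ lines ⟩
        N                                                        ∎
        where
        open ≡-Reasoning
        count : ∀ b c d → (c ≡ true → not b ≡ true) → (d ≡ true → not b ∧ not c ≡ true) →
          ⟦ not b ∧ not c ∧ not d ⟧ + (⟦ c ⟧ + ⟦ d ⟧) ≡ ⟦ not b ⟧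
        count true  true  _     p _ = contradiction (p refl) λ ()
        count true  false true  _ p = contradiction (p refl) λ ()
        count true  false false _ _ = refl
        count false true  true  _ p = contradiction (p refl) λ ()
        count false true  false _ _ = refl
        count false false true  _ _ = refl
        count false false false _ _ = refl

      rest-count : ∣ (λ x → not (side x) ∧ not (S₁ x)) ∣ + ∣ S₁ ∣ ≡ N
      rest-count = trans (sym (∑-+ (λ x → ⟦ not (side x) ∧ not (S₁ x) ⟧) _))
        (trans (∑-cong λ x → count (side x) (S₁ x) (proj₁ ind₁)) lines)
        where
        count : ∀ b c → (c ≡ true → not b ≡ true) → ⟦ not b ∧ not c ⟧ + ⟦ c ⟧ ≡ ⟦ not b ⟧
        count true  true  p = contradiction (p refl) λ ()
        count true  false _ = refl
        count false true  _ = refl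
        count false false _ = refl

  -- Arithmetic

  geometric-factor₃ : ∀ q → geometric q 5 ≡ suc q * (q ^ 4 + q ^ 2 + 1)
  geometric-factor₃ = unfolded
    where
    -- The powers are spelled out as the products to which `_^_` reduces, so the solved equation is
    -- the statement by computation; likewise below.
    unfolded : ∀ q → let q² = q * (q * 1) ; q³ = q * q² ; q⁴ = q * q³ in
        1 + q * (1 + q * (1 + q * (1 + q * (1 + q * 1)))) ≡ suc q * (q⁴ + q² + 1)
    unfolded = solve-∀

  geometric-factor₅ : ∀ q → geometric q 5 ≡ (q ^ 2 + q + 1) * (q ^ 3 + 1)
  geometric-factor₅ = unfolded
    where
    unfolded : ∀ q → let q² = q * (q * 1) ; q³ = q * q² in
        1 + q * (1 + q * (1 + q * (1 + q * (1 + q * 1)))) ≡ (q² + q + 1) * (q³ + 1)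
    unfolded = solve-∀

  geometric-expand : ∀ q → geometric q 5 ≡ q ^ 5 + (q ^ 4 + q ^ 3 + q ^ 2 + q + 1)
  geometric-expand = unfolded
    where
    unfolded : ∀ q → let q² = q * (q * 1) ; q³ = q * q² ; q⁴ = q * q³ ; q⁵ = q * q⁴ in
        1 + q * (1 + q * (1 + q * (1 + q * (1 + q * 1)))) ≡ q⁵ + (q⁴ + q³ + q² + q + 1)
    unfolded = solve-∀

  size₃ : ∀ q s → suc q * s ≤ geometric q 5 → s ≤ q ^ 4 + q ^ 2 + 1
  size₃ q s h = *-cancelˡ-≤ (suc q) (≤-trans h (≤-reflexive (geometric-factor₃ q)))

  -- `(q + 1)²` exceeds `q² + q + 1` by `q`, so the term `q * s` cancels and `q² + q + 1`, a factor
  -- of `geometric q 5`, can be divided out.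
  size₅ : ∀ q s → suc q * (suc q * s) ≤ geometric q 5 + q * s → s ≤ q ^ 3 + 1
  size₅ q s h = *-cancelˡ-≤ (q ^ 2 + q + 1) {{>-nonZero (≤-trans (s≤s z≤n) (≤-reflexive (+-comm 1 _)))}}
    (+-cancelʳ-≤ (q * s) _ _ (begin
      (q ^ 2 + q + 1) * s + q * s              ≡⟨ square q s ⟨
      suc q * (suc q * s)                      ≤⟨ h ⟩
      geometric q 5 + q * s                    ≡⟨ cong (_+ q * s) (geometric-factor₅ q) ⟩
      (q ^ 2 + q + 1) * (q ^ 3 + 1) + q * s    ∎))
    where
    open ≤-Reasoning
    square : ∀ q s → let q² = q * (q * 1) in
        suc q * (suc q * s) ≡ (q² + q + 1) * s + q * s
    square = solve-∀

  -- With m = q³ - q² + q, one of a and b exceeds m as soon as a + b does not stay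
  -- below 2 m + 1.
  size₄ : ∀ q a b → 0 < q →
    suc q * b + suc q * (suc q * a) ≤ geometric q 5 + q * a →
    suc q * a + suc q * (suc q * b) ≤ geometric q 5 + q * b →
    a + b + 2 * q ^ 2 ≤ 2 * q ^ 3 + 2 * q
  size₄ (suc r) a b _ ha hb = ≮⇒≥ λ large → case ≤-total a b of λ where
      (inj₁ a≤b) → impossible b a hb (swapped large) a≤b
      (inj₂ b≤a) → impossible a b ha large b≤a
    where
    q m : ℕ
    q = suc r
    m = q ^ 2 * r + q
    open ≤-Reasoning
    swapped : 2 * q ^ 3 + 2 * q < a + b + 2 * q ^ 2 → 2 * q ^ 3 + 2 * q < b + a + 2 * q ^ 2
    swapped = subst (λ s → 2 * q ^ 3 + 2 * q < s + 2 * q ^ 2) (+-comm a b)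
    two-m : ∀ r → let q = suc r ; q² = q * (q * 1) ; q³ = q * q² in
      2 * q³ + 2 * q ≡ 2 * (q² * r + q) + 2 * q²
    two-m = solve-∀
    regroup : ∀ q x y → let q² = q * (q * 1) in
        suc q * y + suc q * (suc q * x) ≡ q² * x + suc q * (x + y) + q * x
    regroup = solve-∀
    -- Already at `x = m + 1` and `x + y = 2 m + 1` the left side exceeds `geometric q 5`, by `2 q`.
    excess : ∀ r → let q = suc r ; q² = q * (q * 1) ; m = q² * r + q in
      q² * suc m + suc q * suc (2 * m)
        ≡ 1 + q * (1 + q * (1 + q * (1 + q * (1 + q * 1)))) + suc (r + q)
    excess = solve-∀
    impossible : ∀ x y → suc q * y + suc q * (suc q * x) ≤ geometric q 5 + q * x →
      2 * q ^ 3 + 2 * q < x + y + 2 * q ^ 2 → ¬ y ≤ x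
    impossible x y h large y≤x = <⇒≱ (m<m+n (geometric q 5) {suc (r + suc r)} z<s) (begin
      geometric q 5 + suc (r + suc r)                  ≡⟨ excess r ⟨
      q ^ 2 * suc m + suc q * suc (2 * m)
        ≤⟨ +-mono-≤ (*-monoʳ-≤ (q ^ 2) m<x) (*-monoʳ-≤ (suc q) 2m<x+y) ⟩
      q ^ 2 * x + suc q * (x + y)
        ≤⟨ +-cancelʳ-≤ (q * x) _ _ (≤-trans (≤-reflexive (sym (regroup q x y))) h) ⟩
      geometric q 5                                    ∎)
      where
      2m<x+y : 2 * m < x + y
      2m<x+y = +-cancelʳ-< (2 * q ^ 2) _ _ (≤-trans (≤-reflexive (cong suc (sym (two-m r)))) large)
      m<x : m < x
      m<x = *-cancelˡ-< 2 m x (≤-trans 2m<x+y (≤-trans (+-monoʳ-≤ x y≤x) (≤-reflexive (cong (x +_) (sym (+-identityʳ x))))))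

  -- The bound for `s₁` is a fraction, so everything is multiplied by `q + 2`. As `2 * N` is
  -- congruent to -42 modulo `q + 2`, the term 42 / (q + 2) of the lower bound originates here.
  lower-count : ∀ q j s₀ s₁ s₂ s₃ s₄ → let N = geometric q 5 in
    s₀ ≤ N → s₁ * (q + 2) ≤ 2 * N → s₂ ≤ q ^ 4 + q ^ 2 + 1 →
    s₃ + 2 * q ^ 2 ≤ 2 * q ^ 3 + 2 * q → s₄ ≤ q ^ 3 + 1 →
    2 * N ≤ s₀ + s₁ + s₂ + s₃ + s₄ + j →
    (q ^ 5 + 2 * q ^ 2) * (q + 2) ≤ 2 * N + (2 * q ^ 3 + q + 1 + j) * (q + 2)
  lower-count q j s₀ s₁ s₂ s₃ s₄ h₀ h₁ h₂ h₃ h₄ total = begin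
    (q ^ 5 + 2 * q ^ 2) * (q + 2)
      ≤⟨ *-monoˡ-≤ (q + 2) (+-cancelʳ-≤ low (q ^ 5 + 2 * q ^ 2) (s₁ + (2 * q ^ 3 + q + 1 + j)) without-s₁) ⟩
    (s₁ + (2 * q ^ 3 + q + 1 + j)) * (q + 2)                   ≡⟨ *-distribʳ-+ (q + 2) s₁ _ ⟩
    s₁ * (q + 2) + (2 * q ^ 3 + q + 1 + j) * (q + 2)           ≤⟨ +-monoˡ-≤ _ h₁ ⟩
    2 * N + (2 * q ^ 3 + q + 1 + j) * (q + 2)                  ∎
    where
    open ≤-Reasoning
    N low : ℕ
    N = geometric q 5
    low = q ^ 4 + q ^ 3 + q ^ 2 + q + 1
    without-s₀ : N ≤ s₁ + s₂ + s₃ + s₄ + j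
    without-s₀ = +-cancelˡ-≤ N _ _ (begin
      N + N                                ≡⟨ cong (N +_) (+-identityʳ N) ⟨
      2 * N                                ≤⟨ total ⟩
      s₀ + s₁ + s₂ + s₃ + s₄ + j           ≡⟨ reassoc s₀ s₁ s₂ s₃ s₄ j ⟩
      s₀ + (s₁ + s₂ + s₃ + s₄ + j)         ≤⟨ +-monoˡ-≤ _ h₀ ⟩
      N + (s₁ + s₂ + s₃ + s₄ + j)          ∎)
      where
      reassoc : ∀ s₀ s₁ s₂ s₃ s₄ j → s₀ + s₁ + s₂ + s₃ + s₄ + j ≡ s₀ + (s₁ + s₂ + s₃ + s₄ + j)
      reassoc = solve-∀
    without-s₁ : q ^ 5 + 2 * q ^ 2 + low ≤ s₁ + (2 * q ^ 3 + q + 1 + j) + low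
    without-s₁ = begin
      q ^ 5 + 2 * q ^ 2 + low                    ≡⟨ +-comm-last (q ^ 5) (2 * q ^ 2) low ⟩
      q ^ 5 + low + 2 * q ^ 2                    ≡⟨ cong (_+ 2 * q ^ 2) (geometric-expand q) ⟨
      N + 2 * q ^ 2                              ≤⟨ +-monoˡ-≤ (2 * q ^ 2) without-s₀ ⟩
      s₁ + s₂ + s₃ + s₄ + j + 2 * q ^ 2          ≡⟨ regroup s₁ s₂ s₃ s₄ j (2 * q ^ 2) ⟩
      s₁ + j + s₂ + (s₃ + 2 * q ^ 2) + s₄        ≤⟨ +-mono-≤ (+-mono-≤ (+-monoʳ-≤ (s₁ + j) h₂) h₃) h₄ ⟩
      s₁ + j + (q ^ 4 + q ^ 2 + 1) + (2 * q ^ 3 + 2 * q) + (q ^ 3 + 1)  ≡⟨ sizes q s₁ j ⟩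
      s₁ + (2 * q ^ 3 + q + 1 + j) + low         ∎
      where
      +-comm-last : ∀ x y z → x + y + z ≡ x + z + y
      +-comm-last = solve-∀
      regroup : ∀ s₁ s₂ s₃ s₄ j x → s₁ + s₂ + s₃ + s₄ + j + x ≡ s₁ + j + s₂ + (s₃ + x) + s₄
      regroup = solve-∀
      sizes : ∀ q s j → let q² = q * (q * 1) ; q³ = q * q² ; q⁴ = q * q³ in
          s + j + (q⁴ + q² + 1) + (2 * q³ + 2 * q) + (q³ + 1) ≡ s + (2 * q³ + q + 1 + j) + (q⁴ + q³ + q² + q + 1)
      sizes = solve-∀

  -- Comparison in base `q`: a strict inequality survives when a digit `c` below `q` is appended on
  -- the left and a zero on the right.
  horner-step : ∀ {x y c q} → suc x ≤ y → c < q → suc (x * q + c) ≤ y * q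
  horner-step {x} {y} {c} {q} x<y c<q = begin
    suc (x * q + c)    ≡⟨ +-suc (x * q) c ⟨
    x * q + suc c      ≤⟨ +-monoʳ-≤ (x * q) c<q ⟩
    x * q + q          ≡⟨ +-comm (x * q) q ⟩
    suc x * q          ≤⟨ *-monoˡ-≤ q x<y ⟩
    y * q              ∎
    where open ≤-Reasoning

  -- The coefficients of q⁵ to q² are those of the gap in `upper-count`, and the same polynomial
  -- suffices in `lower-arithmetic`. From `9 ≤ q` comes 5 q + 27 ≤ 8 q; for q = 8 the inequality
  -- fails.
  sixth-power : ∀ q → 9 ≤ q → 5 * q ^ 5 + 27 * q ^ 4 + 21 * q ^ 3 + 8 * q ^ 2 + 8 * q + 8 ≤ q ^ 6
  sixth-power q 9≤q = begin
    5 * q ^ 5 + 27 * q ^ 4 + 21 * q ^ 3 + 8 * q ^ 2 + 8 * q + 8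
      ≡⟨ horner q ⟩
    ((((5 * q + 27) * q + 21) * q + 8) * q + 8) * q + 8
      ≤⟨ n≤1+n _ ⟩
    suc (((((5 * q + 27) * q + 21) * q + 8) * q + 8) * q + 8)
      ≤⟨ horner-step (horner-step (horner-step quadratic 9≤q) 9≤q) 9≤q ⟩
    q * q * q * q * q * q
      ≡⟨ power q ⟩
    q ^ 6 ∎
    where
    open ≤-Reasoning
    horner : ∀ q → let q² = q * (q * 1) ; q³ = q * q² ; q⁴ = q * q³ ; q⁵ = q * q⁴ in
      5 * q⁵ + 27 * q⁴ + 21 * q³ + 8 * q² + 8 * q + 8 ≡ ((((5 * q + 27) * q + 21) * q + 8) * q + 8) * q + 8
    horner = solve-∀
    power : ∀ q → q * q * q * q * q * q ≡ q * (q * (q * (q * (q * (q * 1)))))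
    power = solve-∀
    regroup : ∀ q → 5 * q + 3 * q ≡ 8 * q
    regroup = solve-∀
    nine : ∀ q → 8 * q * q + q * q ≡ 9 * (q * q)
    nine = solve-∀
    linear : 5 * q + 27 ≤ 8 * q
    linear = ≤-trans (+-monoʳ-≤ (5 * q) (*-monoʳ-≤ 3 9≤q)) (≤-reflexive (regroup q))
    quadratic : suc ((5 * q + 27) * q + 21) ≤ q * q * q
    quadratic = begin
      suc ((5 * q + 27) * q + 21)   ≡⟨ +-suc ((5 * q + 27) * q) 21 ⟨
      (5 * q + 27) * q + 22
        ≤⟨ +-mono-≤ (*-monoˡ-≤ q linear) (≤-trans (m≤m+n 22 59) (*-mono-≤ 9≤q 9≤q)) ⟩
      8 * q * q + q * q             ≡⟨ nine q ⟩
      9 * (q * q)                   ≤⟨ *-monoˡ-≤ (q * q) 9≤q ⟩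
      q * (q * q)                   ≡⟨ *-assoc q q q ⟨
      q * q * q                     ∎

  -- `k ∸ 5` bounds the vertices with colours above 5. For `k < 5` it is 0, and then `few-colours`
  -- contradicts `main`.
  lower-arithmetic : ∀ q k s₀ s₁ s₂ s₃ s₄ → 9 ≤ q → let N = geometric q 5 in
    s₀ ≤ N → s₁ * (q + 2) ≤ 2 * N → s₂ ≤ q ^ 4 + q ^ 2 + 1 →
    s₃ + 2 * q ^ 2 ≤ 2 * q ^ 3 + 2 * q → s₄ ≤ q ^ 3 + 1 →
    2 * N ≤ s₀ + s₁ + s₂ + s₃ + s₄ + (k ∸ 5) →
    (q ^ 5 + 9 * q) * (q + 2) + 42 ≤ (k + 2 * q ^ 4 + 4 * q ^ 2 + 18) * (q + 2)
  lower-arithmetic q k s₀ s₁ s₂ s₃ s₄ 9≤q h₀ h₁ h₂ h₃ h₄ total = case 5 ≤? k of λ where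
      (yes 5≤k) → subst (λ n → (q ^ 5 + 9 * q) * (q + 2) + 42 ≤ (n + 2 * q ^ 4 + 4 * q ^ 2 + 18) * (q + 2))
        (m+[n∸m]≡n 5≤k)
        (+-cancelʳ-≤ _ _ _ (≤-trans (+-monoʳ-≤ _ main) (≤-reflexive (balance q (k ∸ 5)))))
      (no k<5) → contradiction
        (subst (λ j → (q ^ 5 + 2 * q ^ 2) * (q + 2) ≤ 2 * N + (2 * q ^ 3 + q + 1 + j) * (q + 2))
          (m≤n⇒m∸n≡0 (<⇒≤ (≰⇒> k<5))) main)
        (<⇒≱ few-colours)
    where
    N : ℕ
    N = geometric q 5
    main : (q ^ 5 + 2 * q ^ 2) * (q + 2) ≤ 2 * N + (2 * q ^ 3 + q + 1 + (k ∸ 5)) * (q + 2)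
    main = lower-count q (k ∸ 5) s₀ s₁ s₂ s₃ s₄ h₀ h₁ h₂ h₃ h₄ total
    balance : ∀ q j → let q² = q * (q * 1) ; q³ = q * q² ; q⁴ = q * q³ ; q⁵ = q * q⁴ in
        (q⁵ + 9 * q) * (q + 2) + 42
          + (2 * (1 + q * (1 + q * (1 + q * (1 + q * (1 + q * 1))))) + (2 * q³ + q + 1 + j) * (q + 2))
        ≡ (5 + j + 2 * q⁴ + 4 * q² + 18) * (q + 2) + (q⁵ + 2 * q²) * (q + 2)
    balance = solve-∀
    expand : ∀ q → let q² = q * (q * 1) ; q³ = q * q² ; q⁴ = q * q³ ; q⁵ = q * q⁴ in
      suc (2 * (1 + q * (1 + q * (1 + q * (1 + q * (1 + q * 1))))) + (2 * q³ + q + 1 + 0) * (q + 2))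
        + (5 * q⁵ + 23 * q⁴ + 17 * q³ + 9 * q² + 3 * q + 3) + q * q⁵
      ≡ (q⁵ + 2 * q²) * (q + 2) + (5 * q⁵ + 27 * q⁴ + 21 * q³ + 8 * q² + 8 * q + 8)
    expand = solve-∀
    few-colours : 2 * N + (2 * q ^ 3 + q + 1 + 0) * (q + 2) < (q ^ 5 + 2 * q ^ 2) * (q + 2)
    few-colours = ≤-trans (m≤m+n _ _) (+-cancelʳ-≤ _ _ _
      (≤-trans (+-monoʳ-≤ _ (sixth-power q 9≤q)) (≤-reflexive (expand q))))

  -- With E = (q + 1) (q + 2) and F = q⁴ + q² + 1: the hypotheses say E s ≥ 2 N and
  -- E t ≥ 2 (N - s), whence E (q + 2) (s + t) ≥ 2 (q + 2) N + 2 (q² + 3 q) F.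
  upper-count : ∀ q s t u → 9 ≤ q → let N = geometric q 5 in
    2 * N ≤ suc q * suc (suc q) * s → 2 * u ≤ suc q * suc (suc q) * t → u + s ≡ N →
    3 * q ^ 3 + 2 * q ^ 2 + q ≤ s + t
  upper-count q s t u 9≤q hs ht u+s = *-cancelˡ-≤ (E * suc (suc q)) (begin
    E * suc (suc q) * (3 * q ^ 3 + 2 * q ^ 2 + q)
      ≤⟨ +-cancelʳ-≤ _ _ _ (≤-trans (m≤m+n _ (16 * q + 12)) (≤-trans (≤-reflexive (sym (slack q))) (+-monoʳ-≤ _ (sixth-power q 9≤q)))) ⟩
    (q ^ 2 + 3 * q) * (2 * F) + 2 * N * suc (suc q)
      ≤⟨ +-monoˡ-≤ _ (*-monoʳ-≤ (q ^ 2 + 3 * q) 2F≤) ⟩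
    (q ^ 2 + 3 * q) * (suc (suc q) * s) + 2 * N * suc (suc q)
      ≡⟨ cong (λ n → (q ^ 2 + 3 * q) * (suc (suc q) * s) + 2 * n * suc (suc q)) u+s ⟨
    (q ^ 2 + 3 * q) * (suc (suc q) * s) + 2 * (u + s) * suc (suc q)
      ≡⟨ collect q s u ⟩
    suc (suc q) * (E * s + 2 * u)
      ≤⟨ *-monoʳ-≤ (suc (suc q)) (+-monoʳ-≤ (E * s) ht) ⟩
    suc (suc q) * (E * s + E * t)
      ≡⟨ factor (suc (suc q)) E s t ⟩
    E * suc (suc q) * (s + t) ∎)
    where
    open ≤-Reasoning
    N E F : ℕ
    N = geometric q 5
    E = suc q * suc (suc q)
    F = q ^ 4 + q ^ 2 + 1
    2F≤ : 2 * F ≤ suc (suc q) * s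
    2F≤ = *-cancelˡ-≤ (suc q) (begin
      suc q * (2 * F)              ≡⟨ double (suc q) F ⟩
      2 * (suc q * F)              ≡⟨ cong (2 *_) (geometric-factor₃ q) ⟨
      2 * N                        ≤⟨ hs ⟩
      E * s                        ≡⟨ *-assoc (suc q) (suc (suc q)) s ⟩
      suc q * (suc (suc q) * s)    ∎)
      where
      double : ∀ m n → m * (2 * n) ≡ 2 * (m * n)
      double = solve-∀
    collect : ∀ q s u → let q² = q * (q * 1) in
        (q² + 3 * q) * (suc (suc q) * s) + 2 * (u + s) * suc (suc q) ≡ suc (suc q) * (suc q * suc (suc q) * s + 2 * u)
    collect = solve-∀
    factor : ∀ m e s t → m * (e * s + e * t) ≡ e * m * (s + t)
    factor = solve-∀
    slack : ∀ q → let q² = q * (q * 1) ; q³ = q * q² ; q⁴ = q * q³ ; q⁵ = q * q⁴ in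
      (q² + 3 * q) * (2 * (q⁴ + q² + 1)) + 2 * (1 + q * (1 + q * (1 + q * (1 + q * (1 + q * 1))))) * suc (suc q)
        + (5 * q⁵ + 27 * q⁴ + 21 * q³ + 8 * q² + 8 * q + 8)
      ≡ suc q * suc (suc q) * suc (suc q) * (3 * q³ + 2 * q² + q) + q * q⁵ + (16 * q + 12)
    slack = solve-∀

  upper-arithmetic : ∀ q ℓ s → 3 * q ^ 3 + 2 * q ^ 2 + q ≤ s → ℓ + s ≡ geometric q 5 →
    3 + ℓ + (2 * q ^ 3 + q ^ 2) ≤ q ^ 5 + q ^ 4 + 4
  upper-arithmetic q ℓ s large ℓ+s = +-cancelʳ-≤ (q ^ 3 + q ^ 2 + q) _ _ (begin
    3 + ℓ + (2 * q ^ 3 + q ^ 2) + (q ^ 3 + q ^ 2 + q)    ≡⟨ gather q ℓ ⟩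
    3 + (ℓ + (3 * q ^ 3 + 2 * q ^ 2 + q))                ≤⟨ +-monoʳ-≤ 3 (+-monoʳ-≤ ℓ large) ⟩
    3 + (ℓ + s)                                          ≡⟨ cong (3 +_) (trans ℓ+s (geometric-expand q)) ⟩
    3 + (q ^ 5 + (q ^ 4 + q ^ 3 + q ^ 2 + q + 1))        ≡⟨ spread q ⟩
    q ^ 5 + q ^ 4 + 4 + (q ^ 3 + q ^ 2 + q)              ∎)
    where
    open ≤-Reasoning
    gather : ∀ q ℓ → let q² = q * (q * 1) ; q³ = q * q² in
        3 + ℓ + (2 * q³ + q²) + (q³ + q² + q) ≡ 3 + (ℓ + (3 * q³ + 2 * q² + q))
    gather = solve-∀
    spread : ∀ q → let q² = q * (q * 1) ; q³ = q * q² ; q⁴ = q * q³ ; q⁵ = q * q⁴ in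
        3 + (q⁵ + (q⁴ + q³ + q² + q + 1)) ≡ q⁵ + q⁴ + 4 + (q³ + q² + q)
    spread = solve-∀

  -- The two bounds

  -- The division is exact: 2 q⁶ - 2 is `2 * geometric q 5` times q - 1.
  n₀-geometric : ∀ q .{{_ : NonZero (q + 1 ∸ 2)}} → 9 ≤ q → n₀ (q + 1) 12 ≡ 2 * geometric q 5
  n₀-geometric (suc p) _ = exact (begin
    2 * (p + 1) ^ 6 ∸ 2                      ≡⟨ cong (λ q → 2 * q ^ 6 ∸ 2) (+-comm p 1) ⟩
    2 * suc p ^ 6 ∸ 2                         ≡⟨ cong (_∸ 2) (factor p) ⟩
    2 + 2 * geometric (suc p) 5 * p ∸ 2      ≡⟨ m+n∸m≡n 2 _ ⟩
    2 * geometric (suc p) 5 * p                 ≡⟨ cong (2 * geometric (suc p) 5 *_) (m+n∸n≡m p 1) ⟨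
    2 * geometric (suc p) 5 * (p + 1 ∸ 1)    ∎)
    where
    open ≡-Reasoning
    open ℕ using (suc)
    exact : ∀ {m n d} .{{_ : NonZero d}} → m ≡ n * d → m / d ≡ n
    exact {n = n} {d} refl = m*n/n≡m n d
    factor : ∀ p → let q = suc p in
      2 * (q * (q * (q * (q * (q * (q * 1))))))
        ≡ 2 + 2 * (1 + q * (1 + q * (1 + q * (1 + q * (1 + q * 1))))) * p
    factor = solve-∀

  -- Truncated subtraction lets this cover `k < n`, when the left sum is a part of the right one.
  sum-tail : ∀ n k (s : ℕ → ℕ) → (∀ i → n ≤ i → s i ≤ 1) →
    sum {k} (s ∘ toℕ) ≤ sum {n} (s ∘ toℕ) + (k ∸ n)
  sum-tail zero k s s≤1 = ≤-trans (sum-mono {k} λ i → s≤1 (toℕ i) z≤n)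
    (≤-reflexive (trans (sum-const k 1) (*-identityʳ k)))
    where open ℕ using (zero)
  sum-tail (suc n) zero    s s≤1 = z≤n
  sum-tail (suc n) (suc k) s s≤1 = ≤-trans
    (+-monoʳ-≤ (s 0) (sum-tail n k (s ∘ suc) λ i n≤i → s≤1 (suc i) (s≤s n≤i)))
    (≤-reflexive (sym (+-assoc (s 0) _ _)))

  module Hexagon {q : ℕ} (9≤q : 9 ≤ q) (G : Graph) (reg : Graph.IsRegular G (suc q))
    (size : Graph.order G ≡ 2 * geometric q 5)
    (side : Graph.Vertex G → Bool) (side-flip : Alternates G side)
    (diameter≤6 : DiameterAtMost6 G) (no-square : NoSquare G) (no-hexagon : NoHexagon G) where
    open Graph G hiding (χρ)
    open Adjacency G
    open Bipartite {N = geometric q 5} G reg size side side-flip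
    open PartialSpreads (≤-trans (s≤s z≤n) 9≤q) G reg no-square no-hexagon
      using (IndependentIn; ¬¬large-independent; module Colouring)

    module _ {k} (Γ : Vertex → Fin k) (packing : IsPackingColouring Γ) where

      -- Indices start at 0: `class i` holds the vertices of colour `i + 1` and is empty for
      -- `i ≥ k`, so classes 0 to 4 make sense for every `k`.
      class : ℕ → Vertex → Bool
      class i x = does (toℕ (Γ x) ≟ i)

      module Class i = Codes no-square (class i)

      separated : ∀ i → Class.Separated i (suc i)
      separated i {x} {y} {m} x∈ y∈ m≤ W = decidable-stable (x ≟ᶠ y) λ x≢y →
        let Γx≡i = does-true (toℕ (Γ x) ≟ i) x∈
            Γy≡i = does-true (toℕ (Γ y) ≟ i) y∈
            -- The colouring condition speaks of distances, so the given walk is replaced by a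
            -- shortest one.
            d , shortest , minimal = least (walk? x y) m W
            far = packing x y x≢y (toℕ-injective (trans Γx≡i (sym Γy≡i))) d (shortest , minimal)
        in <⇒≱ (m<m+n (suc i) z<s)
             (≤-trans (subst (λ j → suc j + 1 ≤ d) Γx≡i far) (≤-trans (minimal m W) m≤))

      class-size : ℕ → ℕ
      class-size i = ∣ class i ∣

      classes-cover : order ≤ sum {k} (class-size ∘ toℕ)
      classes-cover = begin
        order                       ≡⟨ ∑-1 ⟨
        ∑ (λ _ → 1)
          ≤⟨ ∑-mono (λ x → ≤-trans (≤-reflexive (sym (⟦⟧-yes (toℕ (Γ x) ≟ toℕ (Γ x)) refl)))
              (term≤sum {k} (λ c → ⟦ class (toℕ c) x ⟧) (Γ x))) ⟩
        ∑ (λ x → sum {k} (λ c → ⟦ class (toℕ c) x ⟧))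
          ≡⟨ ∑-comm {order} {k} (λ x c → ⟦ class (toℕ c) x ⟧) ⟩
        sum {k} (class-size ∘ toℕ)  ∎
        where open ≤-Reasoning

      fourth-class : class-size 3 + 2 * q ^ 2 ≤ 2 * q ^ 3 + 2 * q
      fourth-class = subst (λ s → s + 2 * q ^ 2 ≤ 2 * q ^ 3 + 2 * q) (sym (∑-split (Class.φ 3)))
        (size₄ q α β (≤-trans (s≤s z≤n) 9≤q)
          (Class.separated-4-bound 3 (separated 3) side side-flip)
          (subst (λ s → suc q * s + suc q * (suc q * β) ≤ geometric q 5 + q * β)
            (∑-cong λ u → cong (λ b → ⟦ b ⟧ * Class.φ 3 u) (not-involutive (side u)))
            (Class.separated-4-bound 3 (separated 3) (not ∘ side) opposite-flip)))
        where
        α β : ℕ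
        α = ∑ (λ u → ⟦ side u ⟧ * Class.φ 3 u)
        β = ∑ (λ u → ⟦ not (side u) ⟧ * Class.φ 3 u)

      lower-bound : (q ^ 5 + 9 * q) * (q + 2) + 42
        ≤ (k + 2 * q ^ 4 + 4 * q ^ 2 + 18) * (q + 2)
      lower-bound = lower-arithmetic q k (class-size 0) (class-size 1) (class-size 2) (class-size 3) (class-size 4) 9≤q
        (Class.independent-bound 0 (separated 0))
        (Class.separated-2-bound 1 (separated 1))
        (size₃ q _ (Class.separated-3-bound 2 (separated 2)))
        fourth-class
        (size₅ q _ (Class.separated-5-bound 4 (separated 4)))
        (begin
          2 * geometric q 5                                ≡⟨ size ⟨
          order                                              ≤⟨ classes-cover ⟩
          sum {k} (class-size ∘ toℕ)
            ≤⟨ sum-tail 5 k class-size (λ i 5≤i → Class.separated-6-bound i diameter≤6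
              (Class.weaken i (s≤s 5≤i) (separated i))) ⟩
          sum {5} (class-size ∘ toℕ) + (k ∸ 5)
            ≡⟨ cong (_+ (k ∸ 5)) (reassoc (class-size 0) (class-size 1) (class-size 2) (class-size 3) (class-size 4)) ⟩
          class-size 0 + class-size 1 + class-size 2 + class-size 3 + class-size 4 + (k ∸ 5)  ∎)
        where
        open ≤-Reasoning
        reassoc : ∀ s₀ s₁ s₂ s₃ s₄ → s₀ + (s₁ + (s₂ + (s₃ + (s₄ + 0)))) ≡ s₀ + s₁ + s₂ + s₃ + s₄
        reassoc = solve-∀

    upper-bound : χρ G + (2 * q ^ 3 + q ^ 2) ≤ q ^ 5 + q ^ 4 + 4
    -- A decidable inequality is stable, so both spreads may be taken from under their double
    -- negations.
    upper-bound = decidable-stable (_ ≤? _) λ fails →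
      ¬¬large-independent (not ∘ side) λ (S₁ , ind₁ , large₁) →
      -- The second spread is sought among the lines that the first leaves over.
      ¬¬large-independent (λ x → not (side x) ∧ not (S₁ x)) λ (S₂ , ind₂ , large₂) →
      fails (with-spreads S₁ S₂ ind₁ large₁ ind₂ large₂)
      where
      with-spreads : ∀ S₁ S₂ →
        IndependentIn (not ∘ side) S₁ → 2 * ∣ not ∘ side ∣ ≤ suc q * suc (suc q) * ∣ S₁ ∣ →
        IndependentIn (λ x → not (side x) ∧ not (S₁ x)) S₂ →
        2 * ∣ (λ x → not (side x) ∧ not (S₁ x)) ∣ ≤ suc q * suc (suc q) * ∣ S₂ ∣ →
        χρ G + (2 * q ^ 3 + q ^ 2) ≤ q ^ 5 + q ^ 4 + 4
      with-spreads S₁ S₂ ind₁ large₁ ind₂ large₂ = ≤-trans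
        (+-monoˡ-≤ _ (proj₂ χρ-isLeast (3 + length C.leftovers) C.colourable))
        (upper-arithmetic q (length C.leftovers) (∣ S₁ ∣ + ∣ S₂ ∣)
          (upper-count q ∣ S₁ ∣ ∣ S₂ ∣ _ 9≤q
            (subst (λ n → 2 * n ≤ suc q * suc (suc q) * ∣ S₁ ∣) opposite-size large₁)
            large₂ C.rest-count)
          C.leftovers-count)
        where
        module C = Colouring side side-flip opposite-size S₁ S₂ ind₁ ind₂

-- Transfer of the bounds to integers and rationals

open import Data.Nat using (ℕ) renaming (_≤_ to _≤ℕ_; _+_ to _+ℕ_)
open import Data.Integer using (+_; _+_; _-_; _*_; _^_; _≤_)
open import Data.Rational.Unnormalised using (_/_) renaming (_+_ to _+ℚ_; _≤_ to _≤ℚ_)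
open import Data.Product using (_×_)
open import Data.Integer using (-_; +≤+)
import Data.Integer.Properties as ℤ
import Data.Integer.Tactic.RingSolver as ℤSolver
import Data.Nat as ℕ
import Data.Nat.Properties as ℕₚ
open import Data.Product using (_,_; proj₁; proj₂)
open import Data.Rational.Unnormalised using (*≤*)
open import Relation.Binary.PropositionalEquality using (_≡_; refl; sym; trans; cong; cong₂; subst₂)
open PackingBounds using (geometric; n₀-geometric; module Moore; module Hexagon)

pos-^ : ∀ q n → + (q ℕ.^ n) ≡ (+ q) ^ n
pos-^ q ℕ.zero    = refl
pos-^ q (ℕ.suc n) = trans (ℤ.pos-* q (q ℕ.^ n)) (cong (+ q *_) (pos-^ q n))

+-cancelʳ-≤ : ∀ i j k → i + k ≤ j + k → i ≤ j
+-cancelʳ-≤ i j k h = subst₂ _≤_ (cancel i k) (cancel j k) (ℤ.+-monoˡ-≤ (- k) h)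
  where
  cancel : ∀ i k → i + k + - k ≡ i
  cancel = ℤSolver.solve-∀

upper-cast : ∀ q c → c +ℕ (2 ℕ.* q ℕ.^ 3 +ℕ q ℕ.^ 2) ≤ℕ q ℕ.^ 5 +ℕ q ℕ.^ 4 +ℕ 4 →
  + c ≤ (+ q) ^ 5 + (+ q) ^ 4 - + 2 * (+ q) ^ 3 - (+ q) ^ 2 + + 4
upper-cast q c h = +-cancelʳ-≤ _ _ (+ 2 * (+ q) ^ 3 + (+ q) ^ 2) (begin
  + c + (+ 2 * (+ q) ^ 3 + (+ q) ^ 2)
    ≡⟨ cong (_+_ (+ c)) (cong₂ _+_ (trans (ℤ.pos-* 2 (q ℕ.^ 3)) (cong (_*_ (+ 2)) (pos-^ q 3))) (pos-^ q 2)) ⟨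
  + (c +ℕ (2 ℕ.* q ℕ.^ 3 +ℕ q ℕ.^ 2))            ≤⟨ +≤+ h ⟩
  + (q ℕ.^ 5 +ℕ q ℕ.^ 4 +ℕ 4)                    ≡⟨ cong (_+ + 4) (cong₂ _+_ (pos-^ q 5) (pos-^ q 4)) ⟩
  (+ q) ^ 5 + (+ q) ^ 4 + + 4
    ≡⟨ rearrange ((+ q) ^ 5) ((+ q) ^ 4) ((+ q) ^ 3) ((+ q) ^ 2) ⟩
  (+ q) ^ 5 + (+ q) ^ 4 - + 2 * (+ q) ^ 3 - (+ q) ^ 2 + + 4 + (+ 2 * (+ q) ^ 3 + (+ q) ^ 2)  ∎)
  where
  open ℤ.≤-Reasoning
  rearrange : ∀ x y z w → x + y + + 4 ≡ x + y - + 2 * z - w + + 4 + (+ 2 * z + w)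
  rearrange = ℤSolver.solve-∀

-- Cross-multiplied, with the negative terms moved to the other side, the rational inequality
-- becomes one between naturals; the factors `+ 1` come from the denominators.
lower-cast : ∀ q c → (q ℕ.^ 5 +ℕ 9 ℕ.* q) ℕ.* (q +ℕ 2) +ℕ 42
    ≤ℕ (c +ℕ 2 ℕ.* q ℕ.^ 4 +ℕ 4 ℕ.* q ℕ.^ 2 +ℕ 18) ℕ.* (q +ℕ 2) → let Q = + q in
  (Q ^ 5 - + 2 * Q ^ 4 - + 4 * Q ^ 2 + + 9 * Q - + 18) / 1 +ℚ + 42 / (2 +ℕ q) ≤ℚ + c / 1
lower-cast q c h = *≤* (+-cancelʳ-≤ _ _ ((+ 2 * Q ^ 4 + + 4 * Q ^ 2 + + 18) * (Q + + 2)) (begin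
  ((Q ^ 5 - + 2 * Q ^ 4 - + 4 * Q ^ 2 + + 9 * Q - + 18) * (+ 2 + Q) + + 42 * + 1) * + 1
      + (+ 2 * Q ^ 4 + + 4 * Q ^ 2 + + 18) * (Q + + 2)
    ≡⟨ expandˡ Q (Q ^ 2) (Q ^ 4) (Q ^ 5) ⟩
  (Q ^ 5 + + 9 * Q) * (Q + + 2) + + 42
    ≡⟨ cong (_+ + 42) (trans (ℤ.pos-* (q ℕ.^ 5 +ℕ 9 ℕ.* q) (q +ℕ 2))
         (cong (_* (Q + + 2)) (cong₂ _+_ (pos-^ q 5) (ℤ.pos-* 9 q)))) ⟨
  + ((q ℕ.^ 5 +ℕ 9 ℕ.* q) ℕ.* (q +ℕ 2) +ℕ 42)
    ≤⟨ +≤+ h ⟩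
  + ((c +ℕ 2 ℕ.* q ℕ.^ 4 +ℕ 4 ℕ.* q ℕ.^ 2 +ℕ 18) ℕ.* (q +ℕ 2))
    ≡⟨ trans (ℤ.pos-* (c +ℕ 2 ℕ.* q ℕ.^ 4 +ℕ 4 ℕ.* q ℕ.^ 2 +ℕ 18) (q +ℕ 2))
         (cong (λ i → (i + + 18) * (Q + + 2))
           (cong₂ _+_ (cong (_+_ (+ c)) (scaled 2 4)) (scaled 4 2))) ⟩
  (+ c + + 2 * Q ^ 4 + + 4 * Q ^ 2 + + 18) * (Q + + 2)
    ≡⟨ expandʳ Q (Q ^ 2) (Q ^ 4) (+ c) ⟩
  + c * (+ 2 + Q) + (+ 2 * Q ^ 4 + + 4 * Q ^ 2 + + 18) * (Q + + 2)
    ≡⟨ cong (λ d → + c * + d + (+ 2 * Q ^ 4 + + 4 * Q ^ 2 + + 18) * (Q + + 2)) (ℕₚ.*-identityˡ (2 +ℕ q)) ⟨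
  + c * + (1 ℕ.* (2 +ℕ q)) + (+ 2 * Q ^ 4 + + 4 * Q ^ 2 + + 18) * (Q + + 2) ∎))
  where
  open ℤ.≤-Reasoning
  Q = + q
  scaled : ∀ m n → + (m ℕ.* q ℕ.^ n) ≡ + m * Q ^ n
  scaled m n = trans (ℤ.pos-* m (q ℕ.^ n)) (cong (_*_ (+ m)) (pos-^ q n))
  expandˡ : ∀ x y z w → ((w - + 2 * z - + 4 * y + + 9 * x - + 18) * (+ 2 + x) + + 42 * + 1) * + 1
      + (+ 2 * z + + 4 * y + + 18) * (x + + 2) ≡ (w + + 9 * x) * (x + + 2) + + 42
  expandˡ = ℤSolver.solve-∀
  expandʳ : ∀ x y z c → (c + + 2 * z + + 4 * y + + 18) * (x + + 2)
    ≡ c * (+ 2 + x) + (+ 2 * z + + 4 * y + + 18) * (x + + 2)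
  expandʳ = ℤSolver.solve-∀

theorem3p3 : (q : ℕ) → IsPrimePower q → IsOdd q → 9 ≤ℕ q →
    (G : Graph) → IsMooreGraph (q +ℕ 1) 12 G →
    let Q = + q in
    ((Q ^ 5 - + 2 * Q ^ 4 - + 4 * Q ^ 2 + + 9 * Q - + 18) / 1 +ℚ + 42 / (2 +ℕ q) ≤ℚ + χρ G / 1)
    × (+ χρ G ≤ Q ^ 5 + Q ^ 4 - + 2 * Q ^ 3 - Q ^ 2 + + 4)
theorem3p3 q _ _ 9≤q G moore =
  lower-cast q (χρ G) (lower-bound (proj₁ colouring) (proj₂ colouring)) , upper-cast q (χρ G) upper-bound
  where
  open IsMooreGraph moore
  reg : Graph.IsRegular G (ℕ.suc q)
  reg v = trans (regular v) (ℕₚ.+-comm q 1)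
  order≡ : Graph.order G ≡ 2 ℕ.* geometric q 5
  order≡ = trans size (n₀-geometric q {{ℕ.>-nonZero (ℕₚ.m<n⇒0<n∸m k≥3)}} 9≤q)
  open Moore G reg (proj₂ girth) order≡ using (side; side-flip; diameter≤6; no-square; no-hexagon)
  open Hexagon 9≤q G reg order≡ side side-flip diameter≤6 no-square no-hexagon using (lower-bound; upper-bound)
  colouring : Graph.PackingColourable G (χρ G)
  colouring = proj₁ (Graph.χρ-isLeast G)
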